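{- For any fixed $\epsilon > 0$, there is a deterministic two-pass streaming algorithm that, for every general (not necessarily bipartite) graph $G$ on $n$ vertices whose edges arrive in a stream in arbitrary order, finds the edges of a $(2-\sqrt{2}-\epsilon)$-approximate maximum matching of $G$, i.e. outputs a matching of $G$ of size at least $(2-\sqrt{2}-\epsilon)\cdot\mu(G)$, using $O(n)$ space.
   Context: $\mu(G)$ denotes the size of a maximum matching of $G$. Streaming model: the edges of the input graph $G$ appear one by one in an arbitrary order; a two-pass algorithm makes two passes over the stream and must then output the edges of a matching of $G$, while keeping only limited memory at any time. Space is measured in the number of stored edges (words); since $\epsilon$ is fixed, the constant hidden in $O(n)$ may depend on $\epsilon$. -}

module Defs where

open import Data.Empty using (⊥-elim)
open import Data.Fin.Base as Fin using (Fin)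
import Data.Fin.Properties as Fin
import Data.Integer.Base as ℤ
import Data.Integer.Properties as ℤ
open import Data.List.Base using (List; []; _∷_; _++_; map; concatMap; filter; foldl; length; allFin)
open import Data.List.Extrema.Nat using (max; v≤max⁺; argmax-sel)
open import Data.List.Membership.Propositional using (_∈_)
open import Data.List.Membership.Propositional.Properties
  using (∈-map⁺; ∈-map⁻; ∈-++⁺ˡ; ∈-++⁺ʳ; ∈-∃++; ∈-concatMap⁺; ∈-filter⁺; ∈-filter⁻; ∈-allFin)
open import Data.List.Relation.Binary.Permutation.Propositional using (_↭_; ↭-sym)
open import Data.List.Relation.Binary.Permutation.Propositional.Properties
  using (shift; ↭-length; All-resp-↭; ∈-resp-↭)
open import Data.List.Relation.Unary.All as All using (All; []; _∷_)
open import Data.List.Relation.Unary.AllPairs as AllPairs using (AllPairs; []; _∷_)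
open import Data.List.Relation.Unary.Any as Any using (Any; here; there)
open import Data.List.Relation.Unary.Unique.Propositional using (Unique)
open import Data.Nat.Base as ℕ using (ℕ; zero; suc; s≤s; z≤n)
import Data.Nat.Properties as ℕ
import Data.Nat.Solver as ℕSolver
open import Data.Product.Base using (_×_; _,_; ∃-syntax; proj₁; proj₂)
open import Data.Rational.Base as ℚ using (ℚ; 0ℚ; 1ℚ; ½; mkℚ; ∣_∣)
import Data.Rational.Properties as ℚ
import Data.Rational.Solver as ℚSolver
import Data.Rational.Unnormalised.Base as ℚᵘ
import Data.Rational.Unnormalised.Properties as ℚᵘ
open import Data.Sum.Base using (inj₁; inj₂)
open import Data.Vec.Bounded.Base using (Vec≤)
open import Function.Bundles using (_⇔_)
open import Level using (0ℓ)
open import Relation.Binary.Core using (Rel)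
open import Relation.Binary.Definitions using (Decidable; Irreflexive; Symmetric)
open import Relation.Binary.PropositionalEquality.Core
  using (_≡_; _≢_; refl; sym; trans; cong; cong₂; subst; subst₂)
open import Relation.Nullary.Decidable using (Dec; yes; no; map′; recompute; _×-dec_; ¬?)
open import Relation.Nullary.Negation using (¬_)

------------------------------------------------------------------------
-- Real numbers

-- Cauchy sequences of rationals, with a modulus; equality of reals is _≃ℝ_, not _≡_.
record ℝ : Set where
  field
    seq    : ℕ → ℚ
    cauchy : ∀ δ → 0ℚ ℚ.< δ →
             ∃[ N ] (∀ m n → N ℕ.≤ m → N ℕ.≤ n → ∣ seq m ℚ.- seq n ∣ ℚ.< δ)

open ℝ public

infix  4 _≃ℝ_ _≤ℝ_ _<ℝ_
infixl 6 _-ℝ_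
infixl 7 _*ℝ_

_≃ℝ_ : Rel ℝ 0ℓ
x ≃ℝ y = ∀ δ → 0ℚ ℚ.< δ → ∃[ N ] (∀ n → N ℕ.≤ n → ∣ seq x n ℚ.- seq y n ∣ ℚ.< δ)

_≤ℝ_ : Rel ℝ 0ℓ
x ≤ℝ y = ∀ δ → 0ℚ ℚ.< δ → ∃[ N ] (∀ n → N ℕ.≤ n → seq x n ℚ.≤ seq y n ℚ.+ δ)

_<ℝ_ : Rel ℝ 0ℓ
x <ℝ y = ∃[ δ ] (0ℚ ℚ.< δ × ∃[ N ] (∀ n → N ℕ.≤ n → seq x n ℚ.+ δ ℚ.≤ seq y n))

private
  0<* : ∀ {p q} → 0ℚ ℚ.< p → 0ℚ ℚ.< q → 0ℚ ℚ.< p ℚ.* q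
  0<* {p} {q} 0<p 0<q =
    subst (ℚ._< p ℚ.* q) (ℚ.*-zeroʳ p) (ℚ.*-monoʳ-<-pos p {{ℚ.positive 0<p}} 0<q)

  half : ∀ δ → ½ ℚ.* δ ℚ.+ ½ ℚ.* δ ≡ δ
  half δ = trans (sym (ℚ.*-distribʳ-+ δ ½ ½)) (ℚ.*-identityˡ δ)

  0<½* : ∀ {δ} → 0ℚ ℚ.< δ → 0ℚ ℚ.< ½ ℚ.* δ
  0<½* = 0<* (ℚ.positive⁻¹ ½)

  ∣-∣-sub : ∀ a b c d → ∣ (a ℚ.- b) ℚ.- (c ℚ.- d) ∣ ℚ.≤ ∣ a ℚ.- c ∣ ℚ.+ ∣ b ℚ.- d ∣
  ∣-∣-sub a b c d =
    subst (λ t → ∣ t ∣ ℚ.≤ ∣ a ℚ.- c ∣ ℚ.+ ∣ b ℚ.- d ∣) (lemma a b c d)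
          (ℚ.∣p-q∣≤∣p∣+∣q∣ (a ℚ.- c) (b ℚ.- d))
    where
    open ℚSolver.+-*-Solver
    lemma : ∀ a b c d → (a ℚ.- c) ℚ.- (b ℚ.- d) ≡ (a ℚ.- b) ℚ.- (c ℚ.- d)
    lemma = solve 4 (λ a b c d → ((a :- c) :- (b :- d)) := ((a :- b) :- (c :- d))) refl

  ∣-∣-mul : ∀ a b c d →
            ∣ a ℚ.* b ℚ.- c ℚ.* d ∣ ℚ.≤ ∣ a ∣ ℚ.* ∣ b ℚ.- d ∣ ℚ.+ ∣ d ∣ ℚ.* ∣ a ℚ.- c ∣
  ∣-∣-mul a b c d =
    subst₂ ℚ._≤_ (cong ∣_∣ (lemma a b c d))
                 (cong₂ ℚ._+_ (ℚ.∣p*q∣≡∣p∣*∣q∣ a (b ℚ.- d)) (ℚ.∣p*q∣≡∣p∣*∣q∣ d (a ℚ.- c)))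
           (ℚ.∣p+q∣≤∣p∣+∣q∣ (a ℚ.* (b ℚ.- d)) (d ℚ.* (a ℚ.- c)))
    where
    open ℚSolver.+-*-Solver
    lemma : ∀ a b c d → a ℚ.* (b ℚ.- d) ℚ.+ d ℚ.* (a ℚ.- c) ≡ a ℚ.* b ℚ.- c ℚ.* d
    lemma = solve 4 (λ a b c d → (a :* (b :- d) :+ d :* (a :- c)) := (a :* b :- c :* d)) refl

  bounded : ∀ x → ∃[ B ] (0ℚ ℚ.< B × ∃[ N ] (∀ n → N ℕ.≤ n → ∣ seq x n ∣ ℚ.≤ B))
  bounded x =
    let N , close = cauchy x 1ℚ (ℚ.positive⁻¹ 1ℚ)
        a = seq x N
    in 1ℚ ℚ.+ ∣ a ∣
     , ℚ.+-mono-<-≤ (ℚ.positive⁻¹ 1ℚ) (ℚ.0≤∣p∣ a)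
     , N
     , λ n N≤n → ℚ.≤-trans
         (subst (λ t → ∣ t ∣ ℚ.≤ ∣ seq x n ℚ.- a ∣ ℚ.+ ∣ a ∣) (lemma (seq x n) a)
                (ℚ.∣p+q∣≤∣p∣+∣q∣ (seq x n ℚ.- a) a))
         (ℚ.+-monoˡ-≤ ∣ a ∣ (ℚ.<⇒≤ (close n N N≤n ℕ.≤-refl)))
    where
    open ℚSolver.+-*-Solver
    lemma : ∀ p q → (p ℚ.- q) ℚ.+ q ≡ p
    lemma = solve 2 (λ p q → ((p :- q) :+ q) := p) refl

  scale : ∀ B δ → 0ℚ ℚ.< B → 0ℚ ℚ.< δ → ∃[ η ] (0ℚ ℚ.< η × B ℚ.* η ≡ δ)
  scale B δ 0<B 0<δ = 1/B ℚ.* δ , 0<* 0<1/B 0<δ , eq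
    where
    instance
      B-pos : ℚ.Positive B
      B-pos = ℚ.positive 0<B
      B-nz : ℚ.NonZero B
      B-nz = ℚ.pos⇒nonZero B
    1/B = ℚ.1/ B
    0<1/B = ℚ.positive⁻¹ 1/B {{ℚ.1/pos⇒pos B}}
    eq = trans (sym (ℚ.*-assoc B 1/B δ))
               (trans (cong (ℚ._* δ) (ℚ.*-inverseʳ B)) (ℚ.*-identityˡ δ))

  *-bound : ∀ {p B η t} → p ℚ.≤ B → 0ℚ ℚ.< B → 0ℚ ℚ.≤ t → t ℚ.< η → p ℚ.* t ℚ.< B ℚ.* η
  *-bound {p} {B} {η} {t} p≤B 0<B 0≤t t<η =
    ℚ.≤-<-trans (ℚ.*-monoʳ-≤-nonNeg t {{ℚ.nonNegative 0≤t}} p≤B)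
                (ℚ.*-monoʳ-<-pos B {{ℚ.positive 0<B}} t<η)

fromℚ : ℚ → ℝ
fromℚ q = record
  { seq    = λ _ → q
  ; cauchy = λ δ 0<δ → 0 , λ _ _ _ _ →
      subst (λ t → ∣ t ∣ ℚ.< δ) (sym (ℚ.+-inverseʳ q)) 0<δ
  }

fromℕ : ℕ → ℝ
fromℕ n = fromℚ (ℤ.+ n ℚ./ 1)

_-ℝ_ : ℝ → ℝ → ℝ
x -ℝ y = record
  { seq    = λ n → seq x n ℚ.- seq y n
  ; cauchy = λ δ 0<δ →
      let N₁ , c₁ = cauchy x (½ ℚ.* δ) (0<½* 0<δ)
          N₂ , c₂ = cauchy y (½ ℚ.* δ) (0<½* 0<δ)
      in N₁ ℕ.⊔ N₂ , λ m n N≤m N≤n →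
           ℚ.≤-<-trans (∣-∣-sub (seq x m) (seq y m) (seq x n) (seq y n))
             (subst (_ ℚ.<_) (half δ)
               (ℚ.+-mono-< (c₁ m n (ℕ.m⊔n≤o⇒m≤o N₁ N₂ N≤m) (ℕ.m⊔n≤o⇒m≤o N₁ N₂ N≤n))
                           (c₂ m n (ℕ.m⊔n≤o⇒n≤o N₁ N₂ N≤m) (ℕ.m⊔n≤o⇒n≤o N₁ N₂ N≤n))))
  }

_*ℝ_ : ℝ → ℝ → ℝ
x *ℝ y = record
  { seq    = λ n → seq x n ℚ.* seq y n
  ; cauchy = λ δ 0<δ →
      let A , 0<A , K₁ , x≤A = bounded x
          B , 0<B , K₂ , y≤B = bounded y
          η , 0<η , Aη≡ = scale A (½ ℚ.* δ) 0<A (0<½* 0<δ)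
          θ , 0<θ , Bθ≡ = scale B (½ ℚ.* δ) 0<B (0<½* 0<δ)
          N₁ , c₁ = cauchy x θ 0<θ
          N₂ , c₂ = cauchy y η 0<η
          K = K₁ ℕ.⊔ K₂
          N = N₁ ℕ.⊔ N₂
      in K ℕ.⊔ N , λ m n ≤m ≤n →
           let K≤m = ℕ.m⊔n≤o⇒m≤o K N ≤m
               N≤m = ℕ.m⊔n≤o⇒n≤o K N ≤m
               K≤n = ℕ.m⊔n≤o⇒m≤o K N ≤n
               N≤n = ℕ.m⊔n≤o⇒n≤o K N ≤n
           in ℚ.≤-<-trans (∣-∣-mul (seq x m) (seq y m) (seq x n) (seq y n))
                (subst (_ ℚ.<_) (trans (cong₂ ℚ._+_ Aη≡ Bθ≡) (half δ))
                  (ℚ.+-mono-<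
                    (*-bound (x≤A m (ℕ.m⊔n≤o⇒m≤o K₁ K₂ K≤m)) 0<A (ℚ.0≤∣p∣ (seq y m ℚ.- seq y n))
                             (c₂ m n (ℕ.m⊔n≤o⇒n≤o N₁ N₂ N≤m) (ℕ.m⊔n≤o⇒n≤o N₁ N₂ N≤n)))
                    (*-bound (y≤B n (ℕ.m⊔n≤o⇒n≤o K₁ K₂ K≤n)) 0<B (ℚ.0≤∣p∣ (seq x m ℚ.- seq x n))
                             (c₁ m n (ℕ.m⊔n≤o⇒m≤o N₁ N₂ N≤m) (ℕ.m⊔n≤o⇒m≤o N₁ N₂ N≤n)))))
  }

------------------------------------------------------------------------
-- √2, as the limit of ⌊√(2(k+1)²)⌋ / (k+1)

-- ⌊√m⌋
isqrt : ℕ → ℕ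
isqrt zero    = 0
isqrt (suc m) with suc (isqrt m) ℕ.* suc (isqrt m) ℕ.≤? suc m
... | yes _ = suc (isqrt m)
... | no  _ = isqrt m

isqrt-lower : ∀ m → isqrt m ℕ.* isqrt m ℕ.≤ m
isqrt-lower zero    = z≤n
isqrt-lower (suc m) with suc (isqrt m) ℕ.* suc (isqrt m) ℕ.≤? suc m
... | yes p = p
... | no  _ = ℕ.m≤n⇒m≤1+n (isqrt-lower m)

isqrt-upper : ∀ m → m ℕ.< suc (isqrt m) ℕ.* suc (isqrt m)
isqrt-upper zero    = s≤s z≤n
isqrt-upper (suc m) with suc (isqrt m) ℕ.* suc (isqrt m) ℕ.≤? suc m
... | yes _ = ℕ.≤-<-trans (isqrt-upper m) (ℕ.*-mono-< (ℕ.n<1+n (suc (isqrt m))) (ℕ.n<1+n (suc (isqrt m))))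
... | no ¬p = ℕ.≰⇒> ¬p

root : ℕ → ℕ
root k = isqrt (2 ℕ.* (suc k ℕ.* suc k))

√2-seq : ℕ → ℚ
√2-seq k = ℤ.+ root k ℚ./ suc k

unit : ℕ → ℚ
unit k = ℤ.+ 1 ℚ./ suc k

/-≃ : ∀ a k → ℚ.toℚᵘ (ℤ.+ a ℚ./ suc k) ℚᵘ.≃ ℚᵘ.mkℚᵘ (ℤ.+ a) k
/-≃ a k = ℚ.toℚᵘ-fromℚᵘ (ℚᵘ.mkℚᵘ (ℤ.+ a) k)

/-mono : ∀ a k b l → a ℕ.* suc l ℕ.≤ b ℕ.* suc k → ℤ.+ a ℚ./ suc k ℚ.≤ ℤ.+ b ℚ./ suc l
/-mono a k b l h = ℚ.toℚᵘ-cancel-≤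
  (ℚᵘ.≤-trans (ℚᵘ.≤-reflexive (/-≃ a k))
    (ℚᵘ.≤-trans (ℚᵘ.*≤* (subst₂ ℤ._≤_ (ℤ.pos-* a (suc l)) (ℤ.pos-* b (suc k)) (ℤ.+≤+ h)))
                (ℚᵘ.≤-reflexive (ℚᵘ.≃-sym (/-≃ b l)))))

/-* : ∀ a k b l → (ℤ.+ a ℚ./ suc k) ℚ.* (ℤ.+ b ℚ./ suc l) ≡ ℤ.+ (a ℕ.* b) ℚ./ (suc k ℕ.* suc l)
/-* a k b l = ℚ.toℚᵘ-injective
  (ℚᵘ.≃-trans (ℚ.toℚᵘ-homo-* (ℤ.+ a ℚ./ suc k) (ℤ.+ b ℚ./ suc l))
    (ℚᵘ.≃-trans (ℚᵘ.*-cong (/-≃ a k) (/-≃ b l))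
      (ℚᵘ.≃-trans (ℚᵘ.*≡* (cong (ℤ._* (ℤ.+ (suc k ℕ.* suc l))) (sym (ℤ.pos-* a b))))
                  (ℚᵘ.≃-sym (/-≃ (a ℕ.* b) (l ℕ.+ k ℕ.* suc l))))))

/-+ : ∀ a b k → (ℤ.+ a ℚ./ suc k) ℚ.+ (ℤ.+ b ℚ./ suc k) ≡ ℤ.+ (a ℕ.+ b) ℚ./ suc k
/-+ a b k = ℚ.toℚᵘ-injective
  (ℚᵘ.≃-trans (ℚ.toℚᵘ-homo-+ (ℤ.+ a ℚ./ suc k) (ℤ.+ b ℚ./ suc k))
    (ℚᵘ.≃-trans (ℚᵘ.+-cong (/-≃ a k) (/-≃ b k))
      (ℚᵘ.≃-trans (ℚᵘ.*≡* eq) (ℚᵘ.≃-sym (/-≃ (a ℕ.+ b) k)))))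
  where
  d = ℤ.+ suc k
  eq : (ℤ.+ a ℤ.* d ℤ.+ ℤ.+ b ℤ.* d) ℤ.* d ≡ ℤ.+ (a ℕ.+ b) ℤ.* (ℤ.+ (suc k ℕ.* suc k))
  eq = trans (cong (ℤ._* d) (sym (ℤ.*-distribʳ-+ d (ℤ.+ a) (ℤ.+ b))))
      (trans (ℤ.*-assoc (ℤ.+ (a ℕ.+ b)) d d)
             (cong (ℤ.+ (a ℕ.+ b) ℤ.*_) (sym (ℤ.pos-* (suc k) (suc k)))))

unit-mono : ∀ {N n} → N ℕ.≤ n → unit n ℚ.≤ unit N
unit-mono {N} {n} N≤n = /-mono 1 n 1 N (ℕ.*-monoʳ-≤ 1 (s≤s N≤n))

archimedean : ∀ δ → 0ℚ ℚ.< δ → ∃[ N ] unit N ℚ.< δ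
archimedean δ@(mkℚ (ℤ.+ zero) d-1 c) 0<δ =
  ⊥-elim (ℚ.<-irrefl (sym (ℚ.≃⇒≡ (ℚ.*≡* refl))) 0<δ)
archimedean δ@(mkℚ ℤ.-[1+ a ] d-1 c) (ℚ.*<* ())
archimedean δ@(mkℚ (ℤ.+ suc a) d-1 c) _ =
  suc d-1 , ℚ.toℚᵘ-cancel-< (ℚᵘ.≤-<-trans (ℚᵘ.≤-reflexive (/-≃ 1 (suc d-1))) (ℚᵘ.*<* lt))
  where
  lt : ℤ.+ 1 ℤ.* ℤ.+ suc d-1 ℤ.< ℤ.+ suc a ℤ.* ℤ.+ suc (suc d-1)
  lt = subst₂ ℤ._<_ (ℤ.pos-* 1 (suc d-1)) (ℤ.pos-* (suc a) (suc (suc d-1)))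
         (ℤ.+<+ (ℕ.<-≤-trans (subst (ℕ._< suc (suc d-1)) (sym (ℕ.*-identityˡ (suc d-1))) (ℕ.n<1+n (suc d-1)))
                             (ℕ.m≤m+n (suc (suc d-1)) (a ℕ.* suc (suc d-1)))))

∣-∣-≤ : ∀ {a b δ} → a ℚ.≤ b ℚ.+ δ → b ℚ.≤ a ℚ.+ δ → ∣ a ℚ.- b ∣ ℚ.≤ δ
∣-∣-≤ {a} {b} {δ} a≤ b≤ with ℚ.∣p∣≡p∨∣p∣≡-p (a ℚ.- b)
... | inj₁ eq = subst₂ ℚ._≤_ (sym eq) (lemma b δ) (ℚ.+-monoˡ-≤ (ℚ.- b) a≤)
  where
  open ℚSolver.+-*-Solver
  lemma : ∀ b δ → b ℚ.+ δ ℚ.- b ≡ δ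
  lemma = solve 2 (λ b δ → (b :+ δ :- b) := δ) refl
... | inj₂ eq = subst₂ ℚ._≤_ (trans (swap a b) (sym eq)) (lemma a δ) (ℚ.+-monoˡ-≤ (ℚ.- a) b≤)
  where
  open ℚSolver.+-*-Solver
  lemma : ∀ b δ → b ℚ.+ δ ℚ.- b ≡ δ
  lemma = solve 2 (λ b δ → (b :+ δ :- b) := δ) refl
  swap : ∀ a b → b ℚ.- a ≡ ℚ.- (a ℚ.- b)
  swap = solve 2 (λ a b → (b :- a) := (:- (a :- b))) refl

square-cancel-< : ∀ {a b} → a ℕ.* a ℕ.< b ℕ.* b → a ℕ.< b
square-cancel-< {a} {b} h = ℕ.≰⇒> λ b≤a → ℕ.<⇒≱ h (ℕ.*-mono-≤ b≤a b≤a)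

root-compare : ∀ m n → root m ℕ.* suc n ℕ.< suc (root n) ℕ.* suc m
root-compare m n = square-cancel-<
  (ℕ.≤-<-trans
    (subst₂ ℕ._≤_ (e₁ r m′ n′) (e₂ m′ n′) (ℕ.*-monoˡ-≤ (n′ ℕ.* n′) (isqrt-lower (2 ℕ.* (m′ ℕ.* m′)))))
    (subst₂ ℕ._<_ refl (e₁ s n′ m′) (ℕ.*-monoˡ-< (m′ ℕ.* m′) (isqrt-upper (2 ℕ.* (n′ ℕ.* n′))))))
  where
  open ℕSolver.+-*-Solver
  m′ = suc m
  n′ = suc n
  r = root m
  s = suc (root n)
  e₁ : ∀ r m n → r ℕ.* r ℕ.* (n ℕ.* n) ≡ (r ℕ.* n) ℕ.* (r ℕ.* n)
  e₁ = solve 3 (λ r m n → (r :* r :* (n :* n)) := ((r :* n) :* (r :* n))) refl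
  e₂ : ∀ m n → 2 ℕ.* (m ℕ.* m) ℕ.* (n ℕ.* n) ≡ 2 ℕ.* (n ℕ.* n) ℕ.* (m ℕ.* m)
  e₂ = solve 2 (λ m n → (con 2 :* (m :* m) :* (n :* n)) := (con 2 :* (n :* n) :* (m :* m))) refl

√2-step : ∀ m n → √2-seq m ℚ.≤ √2-seq n ℚ.+ unit n
√2-step m n = subst (√2-seq m ℚ.≤_)
  (trans (cong (λ t → ℤ.+ t ℚ./ suc n) (sym (ℕ.+-comm (root n) 1))) (sym (/-+ (root n) 1 n)))
  (/-mono (root m) m (suc (root n)) n (ℕ.<⇒≤ (root-compare m n)))

√2 : ℝ
√2 = record
  { seq    = √2-seq
  ; cauchy = λ δ 0<δ →
      let N , u<δ = archimedean δ 0<δ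
          near : ∀ m n → N ℕ.≤ n → √2-seq m ℚ.≤ √2-seq n ℚ.+ unit N
          near m n N≤n = ℚ.≤-trans (√2-step m n) (ℚ.+-monoʳ-≤ (√2-seq n) (unit-mono N≤n))
      in N , λ m n N≤m N≤n →
           ℚ.≤-<-trans (∣-∣-≤ (near m n N≤n) (near n m N≤m)) u<δ
  }

√2-nonneg : fromℕ 0 ≤ℝ √2
√2-nonneg δ 0<δ = 0 , λ n _ →
  ℚ.≤-trans (/-mono 0 0 (root n) n z≤n)
            (subst (ℚ._≤ √2-seq n ℚ.+ δ) (ℚ.+-identityʳ (√2-seq n)) (ℚ.+-monoʳ-≤ (√2-seq n) (ℚ.<⇒≤ 0<δ)))

√2-square : √2 *ℝ √2 ≃ℝ fromℕ 2
√2-square δ 0<δ =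
  let η , 0<η , 4η≡δ = scale (ℤ.+ 4 ℚ./ 1) δ (ℚ.positive⁻¹ (ℤ.+ 4 ℚ./ 1)) 0<δ
      N , u<η = archimedean η 0<η
  in N , λ n N≤n →
       ℚ.≤-<-trans (∣-∣-≤ (upper n) (lower n))
         (ℚ.≤-<-trans (four n)
           (subst (_ ℚ.<_) 4η≡δ
             (ℚ.*-monoʳ-<-pos (ℤ.+ 4 ℚ./ 1) (ℚ.≤-<-trans (unit-mono N≤n) u<η))))
  where
  open ℕSolver.+-*-Solver
  K : ℕ → ℕ
  K n = n ℕ.+ n ℕ.* suc n
  err : ℕ → ℚ
  err n = ℤ.+ (4 ℕ.* suc n) ℚ./ suc (K n)
  four : ∀ n → err n ℚ.≤ (ℤ.+ 4 ℚ./ 1) ℚ.* unit n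
  four n = subst (err n ℚ.≤_) (sym (/-* 4 0 1 n))
    (/-mono (4 ℕ.* suc n) (K n) 4 (n ℕ.+ 0)
      (ℕ.≤-reflexive (trans (cong (λ t → 4 ℕ.* suc n ℕ.* suc t) (ℕ.+-identityʳ n))
                            (ℕ.*-assoc 4 (suc n) (suc n)))))
  sq : ∀ n → √2-seq n ℚ.* √2-seq n ≡ ℤ.+ (root n ℕ.* root n) ℚ./ suc (K n)
  sq n = /-* (root n) n (root n) n
  upper : ∀ n → √2-seq n ℚ.* √2-seq n ℚ.≤ (ℤ.+ 2 ℚ./ 1) ℚ.+ err n
  upper n = ℚ.≤-trans
    (subst (ℚ._≤ (ℤ.+ 2 ℚ./ 1)) (sym (sq n))
      (/-mono (root n ℕ.* root n) (K n) 2 0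
        (subst (ℕ._≤ 2 ℕ.* suc (K n)) (sym (ℕ.*-identityʳ (root n ℕ.* root n))) (isqrt-lower _))))
    (subst (ℚ._≤ (ℤ.+ 2 ℚ./ 1) ℚ.+ err n) (ℚ.+-identityʳ (ℤ.+ 2 ℚ./ 1))
      (ℚ.+-monoʳ-≤ (ℤ.+ 2 ℚ./ 1) (/-mono 0 0 (4 ℕ.* suc n) (K n) z≤n)))
  lower : ∀ n → (ℤ.+ 2 ℚ./ 1) ℚ.≤ √2-seq n ℚ.* √2-seq n ℚ.+ err n
  lower n = subst ((ℤ.+ 2 ℚ./ 1) ℚ.≤_)
    (trans (sym (/-+ (r ℕ.* r) (4 ℕ.* n′) (K n))) (cong (ℚ._+ err n) (sym (sq n))))
    (/-mono 2 0 (r ℕ.* r ℕ.+ 4 ℕ.* n′) (K n)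
      (subst (2 ℕ.* (n′ ℕ.* n′) ℕ.≤_) (sym (ℕ.*-identityʳ _))
        (ℕ.≤-pred (ℕ.≤-trans (isqrt-upper (2 ℕ.* (n′ ℕ.* n′)))
          (subst (ℕ._≤ suc (r ℕ.* r ℕ.+ 4 ℕ.* n′)) (sym (expand r))
            (s≤s (ℕ.+-monoʳ-≤ (r ℕ.* r) (subst (2 ℕ.* r ℕ.≤_) (sym (ℕ.*-assoc 2 2 n′)) (ℕ.*-monoʳ-≤ 2 r≤2n)))))))))
    where
    n′ = suc n
    r = root n
    expand : ∀ r → suc r ℕ.* suc r ≡ suc (r ℕ.* r ℕ.+ 2 ℕ.* r)
    expand = solve 1 (λ r → ((con 1 :+ r) :* (con 1 :+ r)) := (con 1 :+ (r :* r :+ con 2 :* r))) refl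
    r≤2n : r ℕ.≤ 2 ℕ.* n′
    r≤2n = ℕ.≮⇒≥ λ 2n<r → ℕ.<⇒≱ (ℕ.*-mono-< 2n<r 2n<r)
      (ℕ.≤-trans (isqrt-lower (2 ℕ.* (n′ ℕ.* n′)))
        (subst (2 ℕ.* (n′ ℕ.* n′) ℕ.≤_) (double n′)
          (ℕ.*-monoˡ-≤ (n′ ℕ.* n′) {2} {4} (s≤s (s≤s z≤n)))))
      where
      double : ∀ k → 4 ℕ.* (k ℕ.* k) ≡ (2 ℕ.* k) ℕ.* (2 ℕ.* k)
      double = solve 1 (λ k → (con 4 :* (k :* k)) := ((con 2 :* k) :* (con 2 :* k))) refl

------------------------------------------------------------------------
-- Finite simple graphs on n labelled vertices

record Graph (n : ℕ) : Set₁ where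
  field
    Adj     : Rel (Fin n) 0ℓ
    symm    : Symmetric Adj
    irrefl  : Irreflexive _≡_ Adj
    adj?    : Decidable Adj

-- Unordered pairs {lo , hi} of distinct vertices, listed in increasing
-- order so that _≡_ is equality of unordered pairs.
record Edge (n : ℕ) : Set where
  constructor edge
  field
    lo hi  : Fin n
    .lo<hi : lo Fin.< hi

open Edge public

_∈E_ : ∀ {n} → Edge n → Graph n → Set
e ∈E G = Graph.Adj G (lo e) (hi e)

Disjoint : ∀ {n} → Rel (Edge n) 0ℓ
Disjoint e f = (lo e ≢ lo f × lo e ≢ hi f) × (hi e ≢ lo f × hi e ≢ hi f)

IsMatching : ∀ {n} → Graph n → List (Edge n) → Set
IsMatching G M = All (_∈E G) M × AllPairs Disjoint M

isMatching? : ∀ {n} (G : Graph n) M → Dec (IsMatching G M)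
isMatching? G M =
  All.all? (λ e → Graph.adj? G (lo e) (hi e)) M ×-dec AllPairs.allPairs? disjoint? M
  where
  disjoint? : Decidable Disjoint
  disjoint? e f = (¬? (lo e Fin.≟ lo f) ×-dec ¬? (lo e Fin.≟ hi f))
            ×-dec (¬? (hi e Fin.≟ lo f) ×-dec ¬? (hi e Fin.≟ hi f))

allEdges : ∀ n → List (Edge n)
allEdges n = concatMap (λ u → concatMap (edges u) (allFin n)) (allFin n)
  module AllEdges where
  edges : Fin n → Fin n → List (Edge n)
  edges u v with u Fin.<? v
  ... | yes u<v = edge u v u<v ∷ []
  ... | no  _   = []

sublists : ∀ {A : Set} → List A → List (List A)
sublists []       = [] ∷ []
sublists (x ∷ xs) = map (x ∷_) (sublists xs) ++ sublists xs

-- Size of a maximum matching, by exhaustive search; characterised by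
-- μ-attained and μ-upper below.
μ : ∀ {n} → Graph n → ℕ
μ {n} G = max 0 (map length (filter (isMatching? G) (sublists (allEdges n))))

μ-attained : ∀ {n} (G : Graph n) → ∃[ M ] (IsMatching G M × length M ≡ μ G)
μ-attained {n} G with argmax-sel (λ k → k) 0 (map length (filter (isMatching? G) (sublists (allEdges n))))
... | inj₁ eq = [] , ([] , []) , sym eq
... | inj₂ μ∈ =
  let M , M∈ , eq = ∈-map⁻ length μ∈
      _ , matching = ∈-filter⁻ (isMatching? G) {xs = sublists (allEdges n)} M∈
  in M , matching , sym eq

private
  _≟ᴱ_ : ∀ {n} (e f : Edge n) → Dec (e ≡ f)
  edge a b _ ≟ᴱ edge c d _ =
    map′ (λ { (refl , refl) → refl }) (λ { refl → refl , refl }) (a Fin.≟ c ×-dec b Fin.≟ d)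

  ∈-allEdges : ∀ {n} (e : Edge n) → e ∈ allEdges n
  ∈-allEdges {n} e@(edge u v u<v) =
    ∈-concatMap⁺ _ {xs = allFin n} (Any.map (λ { refl →
      ∈-concatMap⁺ _ {xs = allFin n} (Any.map (λ { refl → found }) (∈-allFin v)) }) (∈-allFin u))
    where
    found : e ∈ AllEdges.edges n u v
    found with u Fin.<? v
    ... | yes _ = here refl
    ... | no ¬p = ⊥-elim (¬p (recompute (u Fin.<? v) u<v))

  Disjoint-sym : ∀ {n} → Symmetric (Disjoint {n})
  Disjoint-sym ((a , b) , (c , d)) =
    ((λ p → a (sym p)) , (λ p → c (sym p))) , ((λ p → b (sym p)) , (λ p → d (sym p)))

  pull : ∀ {n} {x : Edge n} ys {zs} → AllPairs Disjoint (ys ++ x ∷ zs) → AllPairs Disjoint (x ∷ ys ++ zs)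
  pull []       ps       = ps
  pull {x = x} (y ∷ ys) {zs} (p ∷ ps) with pull ys ps | All-resp-↭ (shift _ ys zs) p
  ... | q ∷ qs | y-x ∷ y-rest = (Disjoint-sym {x = y} {y = x} y-x ∷ q) ∷ y-rest ∷ qs

  normalise : ∀ {n} (G : Graph n) (E M : List (Edge n)) → IsMatching G M →
              (∀ {e} → e ∈ M → e ∈ E) →
              ∃[ S ] (S ∈ sublists E × IsMatching G S × length S ≡ length M × (∀ {e} → e ∈ S → e ∈ M))
  normalise G [] [] _ _ = [] , here refl , ([] , []) , refl , λ ()
  normalise G [] (x ∷ M) _ M⊆E with M⊆E (here refl)
  ... | ()
  normalise G (x ∷ E) M (M∈G , M-disj) M⊆E with Any.any? (x ≟ᴱ_) M
  ... | no x∉M =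
    let S , S∈ , rest = normalise G E M (M∈G , M-disj) M⊆E′
    in S , ∈-++⁺ʳ (map (x ∷_) (sublists E)) S∈ , rest
    where
    M⊆E′ : ∀ {e} → e ∈ M → e ∈ E
    M⊆E′ e∈M with M⊆E e∈M
    ... | here refl = ⊥-elim (x∉M e∈M)
    ... | there e∈E = e∈E
  ... | yes x∈M with ∈-∃++ x∈M
  ... | ys , zs , refl = aux (All-resp-↭ perm M∈G) (pull ys M-disj)
    where
    M′ = ys ++ zs
    perm : ys ++ x ∷ zs ↭ x ∷ M′
    perm = shift x ys zs
    aux : All (_∈E G) (x ∷ M′) → AllPairs Disjoint (x ∷ M′) →
          ∃[ S ] (S ∈ sublists (x ∷ E) × IsMatching G S × length S ≡ length (ys ++ x ∷ zs)
                × (∀ {e} → e ∈ S → e ∈ ys ++ x ∷ zs))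
    aux (x∈G ∷ M′∈G) (x-disj ∷ M′-disj) =
      let S , S∈ , (S∈G , S-disj) , len , S⊆M′ = normalise G E M′ (M′∈G , M′-disj) M′⊆E
      in x ∷ S
       , ∈-++⁺ˡ (∈-map⁺ (x ∷_) S∈)
       , (x∈G ∷ S∈G , All.tabulate (λ e∈S → All.lookup x-disj (S⊆M′ e∈S)) ∷ S-disj)
       , trans (cong suc len) (sym (↭-length perm))
       , λ { (here refl) → x∈M ; (there e∈S) → ∈-resp-↭ (↭-sym perm) (there (S⊆M′ e∈S)) }
      where
      M′⊆E : ∀ {e} → e ∈ M′ → e ∈ E
      M′⊆E e∈M′ with M⊆E (∈-resp-↭ (↭-sym perm) (there e∈M′))
      ... | here refl = ⊥-elim (proj₁ (proj₁ (All.lookup x-disj e∈M′)) refl)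
      ... | there e∈E = e∈E

μ-upper : ∀ {n} (G : Graph n) M → IsMatching G M → length M ℕ.≤ μ G
μ-upper {n} G M matching =
  let S , S∈ , S-matching , len , _ = normalise G (allEdges n) M matching (λ {e} _ → ∈-allEdges e)
  in v≤max⁺ 0 _ (inj₂ (Any.map (λ eq → ℕ.≤-reflexive (trans (sym len) eq))
       (∈-map⁺ length (∈-filter⁺ (isMatching? G) S∈ S-matching))))

------------------------------------------------------------------------
-- Two-pass streaming algorithms

-- The stream lists every edge of G exactly once, in any order.
IsStreamOf : ∀ {n} → Graph n → List (Edge n) → Set
IsStreamOf G s = Unique s × (∀ e → e ∈ s ⇔ e ∈E G)

-- One word of memory has the size of one stored edge: a pair of vertex
-- names.  It may equally hold a vertex or a counter of O(log n) bits.
Word : ℕ → Set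
Word n = Fin n × Fin n

-- Everything that is kept between two consecutive stream items is a
-- value of Memory, so the space bound holds at every moment of every run.
record TwoPassAlgorithm (n space : ℕ) : Set where
  Memory : Set
  Memory = Vec≤ (Word n) space

  field
    initial : Memory
    step₁   : Memory → Edge n → Memory
    between : Memory → Memory
    step₂   : Memory → Edge n → Memory
    output  : Memory → List (Edge n)

  run : List (Edge n) → List (Edge n)
  run stream = output (foldl step₂ (between (foldl step₁ initial stream)) stream)

open TwoPassAlgorithm public using (run)

{-# OPTIONS --safe #-}
module Submission where

-- The first pass builds a maximal matching M greedily; the second one adds greedily edges F between
-- matched and unmatched vertices, at most k per matched vertex and s per unmatched vertex, where
-- k / s ≈ √2 − 1. The output is a maximum matching of M ∪ F.
--
-- Give weight s − k to the edges of M and 1 to those of F, and raise the weight of the edges that F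
-- shares with an optimal matching until one of their ends is saturated. All weighted degrees are at most
-- s, and charging the optimal edges to matched and to saturated vertices bounds the total weight from
-- below by 2 k s / (s + k) · μ(G). Since F is simple and its edges are light, a vertex set S spans at most
-- (1 + 1/L) s ⌊|S|/2⌋ of the weight, so that by Edmonds' matching polytope theorem M ∪ F has a matching
-- of size at least 2 k / (s + k) · L / (L + 1) · μ(G). What is needed of Edmonds' theorem follows by
-- induction on the vertex set: delete a vertex that every maximum matching covers, or else split off a class of
-- Gallai's equivalence relation "no maximum matching misses both".

open import Defs
open import Data.Bool.Base as Bool using (Bool; true; false; not; _∧_; if_then_else_)
import Data.Bool.Properties as Bool
open import Data.Empty using (⊥-elim)
import Data.Empty.Irrelevant as Irrelevant
open import Data.Fin.Base as Fin using (Fin; zero; suc)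
open import Data.Fin.Properties as Fin using (_≟_)
import Data.Integer.Base as ℤ
open import Data.List.Base using (List; []; _∷_; _++_; map; foldr; foldl; length; filter)
open import Data.List.Membership.Propositional using (_∈_)
open import Data.List.Membership.Propositional.Properties using (∈-filter⁺; ∈-filter⁻; ∈-map⁺)
open import Data.List.Properties using (length-++; length-map)
open import Data.List.Relation.Unary.All as All using (All; []; _∷_)
import Data.List.Relation.Unary.All.Properties as All
open import Data.List.Relation.Unary.AllPairs using (AllPairs; []; _∷_)
import Data.List.Relation.Unary.AllPairs.Properties as AllPairs
open import Data.List.Relation.Unary.Any using (here; there)
open import Data.Nat.Base
  using (ℕ; zero; suc; _+_; _*_; _∸_; _⊓_; _⊔_; _≤_; _<_; _≤ᵇ_; z≤n; s≤s; s≤s⁻¹; ⌊_/2⌋; ⌈_/2⌉; NonZero; >-nonZero)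
open import Data.Nat.Induction using (<-wellFounded)
open import Data.Nat.Properties as ℕ hiding (_≟_)
open import Algebra.Properties.Semiring.Sum +-*-semiring
  using (sum; sum-cong-≗; ∑-distrib-+; sum-replicate-zero; *-distribˡ-sum; *-distribʳ-sum)
open import Data.Nat.Tactic.RingSolver using (solve-∀)
open import Data.Product.Base using (_×_; _,_; ∃-syntax; Σ-syntax; proj₁; proj₂)
open import Data.Rational.Base as ℚ using (ℚ)
import Data.Rational.Properties as ℚ
import Data.Rational.Solver as ℚSolver
open import Data.Sum.Base using (_⊎_; inj₁; inj₂; [_,_]′)
open import Data.Vec.Base as Vec using ()
open import Data.Vec.Bounded.Base using (Vec≤)
open import Data.Vec.Properties using (toList∘fromList)
open import Function.Base using (_∘_)
open import Function.Bundles using (module Equivalence)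
open import Induction.WellFounded using (Acc; acc)
open import Relation.Binary.Definitions using (tri<; tri≈; tri>)
open import Relation.Binary.PropositionalEquality
open import Relation.Nullary.Decidable using (Dec; yes; no; does; ¬?; _×-dec_; _⊎-dec_; dec-true)
open import Relation.Nullary.Negation using (¬_)

-- Put x = k / s. An edge of M can carry at most (1 - x) s, since its ends must keep room for k
-- edges of F; the charging wants this weight to pay for two matched ends, which reads 2 s k ≤ (s -
-- k) (s + k), that is x² + 2x ≤ 1. The largest such x is √2 - 1, and there the ratio 2x / (1 + x)
-- equals 2 - √2. Odd sets are the obstacle that separates general graphs from bipartite ones.
-- Degrees at most s allow weight s |S| / 2 inside S, which is noticeably more than s ⌊|S|/2⌋ only
-- when S is small. On a small S the caps, large compared with L², make the unit weights of F
-- negligible beside s; what remains is M and the raises, two matchings with weights at most s - k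
-- and k. The raises are there because an optimal edge that F already holds may have no saturated
-- end, and could then be charged only once.

⟦_⟧ : Bool → ℕ
⟦ true  ⟧ = 1
⟦ false ⟧ = 0

δ : ∀ {n} → Fin n → Fin n → ℕ
δ u v = ⟦ does (u ≟ v) ⟧

δ-refl : ∀ {n} (u : Fin n) → δ u u ≡ 1
δ-refl u with u ≟ u
... | yes _  = refl
... | no u≢u = ⊥-elim (u≢u refl)

δ-≢ : ∀ {n} {u v : Fin n} → u ≢ v → δ u v ≡ 0
δ-≢ {u = u} {v} u≢v with u ≟ v
... | yes u≡v = ⊥-elim (u≢v u≡v)
... | no _    = refl

-- Sums over vertices and over lists.

sum-mono-≤ : ∀ {n} {f g : Fin n → ℕ} → (∀ i → f i ≤ g i) → sum f ≤ sum g
sum-mono-≤ {zero}  f≤g = z≤n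
sum-mono-≤ {suc n} f≤g = +-mono-≤ (f≤g zero) (sum-mono-≤ (f≤g ∘ suc))

sum-mono-< : ∀ {n} {f g : Fin n → ℕ} → (∀ i → f i ≤ g i) → ∀ i → f i < g i → sum f < sum g
sum-mono-< f≤g zero    fi<gi = +-mono-<-≤ fi<gi (sum-mono-≤ (f≤g ∘ suc))
sum-mono-< f≤g (suc i) fi<gi = +-mono-≤-< (f≤g zero) (sum-mono-< (f≤g ∘ suc) i fi<gi)

∑-δ : ∀ {n} a (f : Fin n → ℕ) → sum (λ u → δ a u * f u) ≡ f a
∑-δ {suc n} zero f = trans (cong₂ _+_ (*-identityˡ (f zero)) (sum-replicate-zero n)) (+-identityʳ (f zero))
∑-δ (suc a) f = trans (sum-cong-≗ λ u → cong (_* f (suc u)) (lemma a u)) (∑-δ a (f ∘ suc))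
  where
  lemma : ∀ {n} (a u : Fin n) → δ (suc a) (suc u) ≡ δ a u
  lemma a u with a ≟ u
  ... | yes _ = refl
  ... | no  _ = refl

∑-δ₁ : ∀ {n} (a : Fin n) → sum (δ a) ≡ 1
∑-δ₁ a = trans (sum-cong-≗ λ u → sym (*-identityʳ (δ a u))) (∑-δ a (λ _ → 1))

∑-δ+δ : ∀ {n} (a b : Fin n) → sum (λ u → δ a u + δ b u) ≡ 2
∑-δ+δ a b = trans (∑-distrib-+ (δ a) (δ b)) (cong₂ _+_ (∑-δ₁ a) (∑-δ₁ b))

∑-const : ∀ n c → sum {n} (λ _ → c) ≡ n * c
∑-const zero    c = refl
∑-const (suc n) c = cong (c +_) (∑-const n c)

∑ˡ : {A : Set} → (A → ℕ) → List A → ℕ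
∑ˡ f = foldr (λ x s → f x + s) 0

module _ {A : Set} where

  ∑ˡ-mono : ∀ {f g : A → ℕ} {xs} → All (λ x → f x ≤ g x) xs → ∑ˡ f xs ≤ ∑ˡ g xs
  ∑ˡ-mono []       = z≤n
  ∑ˡ-mono (p ∷ ps) = +-mono-≤ p (∑ˡ-mono ps)

  ∑ˡ-cong : ∀ {f g : A → ℕ} → (∀ x → f x ≡ g x) → ∀ xs → ∑ˡ f xs ≡ ∑ˡ g xs
  ∑ˡ-cong f≗g []       = refl
  ∑ˡ-cong f≗g (x ∷ xs) = cong₂ _+_ (f≗g x) (∑ˡ-cong f≗g xs)

  ∑ˡ-distrib-+ : ∀ (f g : A → ℕ) xs → ∑ˡ (λ x → f x + g x) xs ≡ ∑ˡ f xs + ∑ˡ g xs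
  ∑ˡ-distrib-+ f g []       = refl
  ∑ˡ-distrib-+ f g (x ∷ xs) = trans (cong (f x + g x +_) (∑ˡ-distrib-+ f g xs)) (lemma (f x) (g x) _ _)
    where
    lemma : ∀ a b c d → a + b + (c + d) ≡ a + c + (b + d)
    lemma = solve-∀

  ∑ˡ-* : ∀ c (f : A → ℕ) xs → ∑ˡ (λ x → c * f x) xs ≡ c * ∑ˡ f xs
  ∑ˡ-* c f []       = sym (*-zeroʳ c)
  ∑ˡ-* c f (x ∷ xs) = trans (cong (c * f x +_) (∑ˡ-* c f xs)) (sym (*-distribˡ-+ c (f x) _))

  ∑ˡ-const : ∀ c (xs : List A) → ∑ˡ (λ _ → c) xs ≡ length xs * c
  ∑ˡ-const c []       = refl
  ∑ˡ-const c (x ∷ xs) = cong (c +_) (∑ˡ-const c xs)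

  ∑ˡ-++ : ∀ (f : A → ℕ) xs ys → ∑ˡ f (xs ++ ys) ≡ ∑ˡ f xs + ∑ˡ f ys
  ∑ˡ-++ f []       ys = refl
  ∑ˡ-++ f (x ∷ xs) ys = trans (cong (f x +_) (∑ˡ-++ f xs ys)) (sym (+-assoc (f x) _ _))

  ∑ˡ-map : ∀ {B : Set} (f : B → ℕ) (g : A → B) xs → ∑ˡ f (map g xs) ≡ ∑ˡ (f ∘ g) xs
  ∑ˡ-map f g []       = refl
  ∑ˡ-map f g (x ∷ xs) = cong (f (g x) +_) (∑ˡ-map f g xs)

  ∈⇒≤∑ˡ : ∀ (f : A → ℕ) {x xs} → x ∈ xs → f x ≤ ∑ˡ f xs
  ∈⇒≤∑ˡ f (here refl) = m≤m+n (f _) _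
  ∈⇒≤∑ˡ f (there x∈)  = ≤-trans (∈⇒≤∑ˡ f x∈) (m≤n+m _ _)

  ∑-∑ˡ-comm : ∀ {n} (f : A → Fin n → ℕ) xs →
              sum (λ u → ∑ˡ (λ x → f x u) xs) ≡ ∑ˡ (λ x → sum (f x)) xs
  ∑-∑ˡ-comm {n} f []       = sum-replicate-zero n
  ∑-∑ˡ-comm     f (x ∷ xs) =
    trans (∑-distrib-+ (f x) (λ u → ∑ˡ (λ x → f x u) xs)) (cong (sum (f x) +_) (∑-∑ˡ-comm f xs))

-- Matchings as involutions: a vertex is fixed exactly when it is unmatched.
record Mate {n} (G : Graph n) : Set where
  field
    mate  : Fin n → Fin n
    invol : ∀ v → mate (mate v) ≡ v
    adj   : ∀ {v} → mate v ≢ v → Graph.Adj G v (mate v)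

open Mate public

covered : ∀ {n} → (Fin n → Fin n) → Fin n → ℕ
covered m v = ⟦ not (does (m v ≟ v)) ⟧

covered-fix : ∀ {n} (m : Fin n → Fin n) {v} → m v ≡ v → covered m v ≡ 0
covered-fix m {v} eq with m v ≟ v
... | yes _ = refl
... | no ¬p = ⊥-elim (¬p eq)

covered-move : ∀ {n} (m : Fin n → Fin n) {v} → m v ≢ v → covered m v ≡ 1
covered-move m {v} neq with m v ≟ v
... | yes p = ⊥-elim (neq p)
... | no _  = refl

covered-cong : ∀ {n} (m m′ : Fin n → Fin n) {v} → m v ≡ m′ v → covered m v ≡ covered m′ v
covered-cong m m′ {v} eq = cong (λ w → ⟦ not (does (w ≟ v)) ⟧) eq

cov : ∀ {n} {G : Graph n} → Mate G → ℕ
cov N = sum (covered (mate N))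

-- Adding an edge to a matching and removing one.

module _ {n : ℕ} where

  update : Fin n → Fin n → Fin n → Fin n → (Fin n → Fin n) → Fin n → Fin n
  update a p b q f v = if does (v ≟ a) then p else if does (v ≟ b) then q else f v

  update-cases : ∀ a p b q f v →
                 (v ≡ a × update a p b q f v ≡ p) ⊎ (v ≢ a × v ≡ b × update a p b q f v ≡ q)
                 ⊎ (v ≢ a × v ≢ b × update a p b q f v ≡ f v)
  update-cases a p b q f v with v ≟ a | v ≟ b
  ... | yes v≡a | _       = inj₁ (v≡a , refl)
  ... | no v≢a  | yes v≡b = inj₂ (inj₁ (v≢a , v≡b , refl))
  ... | no v≢a  | no v≢b  = inj₂ (inj₂ (v≢a , v≢b , refl))

  update-fst : ∀ a p b q f → update a p b q f a ≡ p
  update-fst a p b q f with a ≟ a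
  ... | yes _  = refl
  ... | no a≢a = ⊥-elim (a≢a refl)

  update-snd : ∀ a p b q f → b ≢ a → update a p b q f b ≡ q
  update-snd a p b q f b≢a with update-cases a p b q f b
  ... | inj₁ (b≡a , _)              = ⊥-elim (b≢a b≡a)
  ... | inj₂ (inj₁ (_ , _ , eq))    = eq
  ... | inj₂ (inj₂ (_ , b≢b , _))   = ⊥-elim (b≢b refl)

  update-rest : ∀ a p b q f {v} → v ≢ a → v ≢ b → update a p b q f v ≡ f v
  update-rest a p b q f {v} v≢a v≢b with update-cases a p b q f v
  ... | inj₁ (v≡a , _)               = ⊥-elim (v≢a v≡a)
  ... | inj₂ (inj₁ (_ , v≡b , _))    = ⊥-elim (v≢b v≡b)
  ... | inj₂ (inj₂ (_ , _ , eq))     = eq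

  module Add {G : Graph n} (N : Mate G) {a b} (Na≡a : mate N a ≡ a) (Nb≡b : mate N b ≡ b)
             (a~b : Graph.Adj G a b) where

    a≢b : a ≢ b
    a≢b a≡b = Graph.irrefl G a≡b a~b

    private
      m : Fin n → Fin n
      m = update a b b a (mate N)

    avoid : ∀ {v} → v ≢ a → v ≢ b → mate N v ≢ a × mate N v ≢ b
    avoid {v} v≢a v≢b =
        (λ eq → v≢a (trans (sym (invol N v)) (trans (cong (mate N) eq) Na≡a)))
      , (λ eq → v≢b (trans (sym (invol N v)) (trans (cong (mate N) eq) Nb≡b)))

    m-invol : ∀ v → m (m v) ≡ v
    m-invol v with update-cases a b b a (mate N) v
    ... | inj₁ (v≡a , eq) =
      trans (cong m eq) (trans (update-snd a b b a (mate N) (a≢b ∘ sym)) (sym v≡a))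
    ... | inj₂ (inj₁ (_ , v≡b , eq)) = trans (cong m eq) (trans (update-fst a b b a (mate N)) (sym v≡b))
    ... | inj₂ (inj₂ (v≢a , v≢b , eq)) =
      trans (cong m eq) (trans (update-rest a b b a (mate N) (proj₁ (avoid v≢a v≢b)) (proj₂ (avoid v≢a v≢b)))
                               (invol N v))

    m-adj : ∀ {v} → m v ≢ v → Graph.Adj G v (m v)
    m-adj {v} mv≢v with update-cases a b b a (mate N) v
    ... | inj₁ (refl , eq) = subst (Graph.Adj G v) (sym eq) a~b
    ... | inj₂ (inj₁ (_ , refl , eq)) = subst (Graph.Adj G v) (sym eq) (Graph.symm G a~b)
    ... | inj₂ (inj₂ (_ , _ , eq)) =
      subst (Graph.Adj G v) (sym eq) (adj N (λ p → mv≢v (trans eq p)))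

    add : Mate G
    add = record { mate = m ; invol = m-invol ; adj = m-adj }

    add-cases : ∀ v → (v ≡ a × m v ≡ b) ⊎ (v ≢ a × v ≡ b × m v ≡ a) ⊎ (v ≢ a × v ≢ b × m v ≡ mate N v)
    add-cases = update-cases a b b a (mate N)

    add-fst : mate add a ≡ b
    add-fst = update-fst a b b a (mate N)

    add-rest : ∀ {v} → v ≢ a → v ≢ b → mate add v ≡ mate N v
    add-rest = update-rest a b b a (mate N)

    cov-add : cov add ≡ cov N + 2
    cov-add = trans (sum-cong-≗ pointwise)
      (trans (∑-distrib-+ (covered (mate N)) (λ v → δ a v + δ b v)) (cong (cov N +_) (∑-δ+δ a b)))
      where
      pointwise : ∀ v → covered m v ≡ covered (mate N) v + (δ a v + δ b v)
      pointwise v with update-cases a b b a (mate N) v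
      ... | inj₁ (refl , eq) =
        trans (covered-move m (λ p → a≢b (trans (sym p) eq)))
              (sym (cong₂ _+_ (covered-fix (mate N) Na≡a) (cong₂ _+_ (δ-refl a) (δ-≢ (a≢b ∘ sym)))))
      ... | inj₂ (inj₁ (_ , refl , eq)) =
        trans (covered-move m (λ p → a≢b (trans (sym eq) p)))
              (sym (cong₂ _+_ (covered-fix (mate N) Nb≡b) (cong₂ _+_ (δ-≢ a≢b) (δ-refl b))))
      ... | inj₂ (inj₂ (v≢a , v≢b , eq)) =
        trans (covered-cong m (mate N) eq)
              (trans (sym (+-identityʳ _))
                     (cong (covered (mate N) v +_) (sym (cong₂ _+_ (δ-≢ (v≢a ∘ sym)) (δ-≢ (v≢b ∘ sym))))))

  module Remove {G : Graph n} (N : Mate G) {y} (Ny≢y : mate N y ≢ y) where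

    private
      z = mate N y
      m : Fin n → Fin n
      m = update y y z z (mate N)

    remove-cases : ∀ v → (v ≡ y × m v ≡ v) ⊎ (v ≡ z × m v ≡ v)
                         ⊎ (v ≢ y × v ≢ z × m v ≡ mate N v)
    remove-cases v with update-cases y y z z (mate N) v
    ... | inj₁ (v≡y , eq)            = inj₁ (v≡y , trans eq (sym v≡y))
    ... | inj₂ (inj₁ (_ , v≡z , eq)) = inj₂ (inj₁ (v≡z , trans eq (sym v≡z)))
    ... | inj₂ (inj₂ rest)           = inj₂ (inj₂ rest)

    avoid : ∀ {v} → v ≢ y → v ≢ z → mate N v ≢ y × mate N v ≢ z
    avoid {v} v≢y v≢z =
        (λ eq → v≢z (trans (sym (invol N v)) (cong (mate N) eq)))
      , (λ eq → v≢y (trans (sym (invol N v)) (trans (cong (mate N) eq) (invol N y))))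

    m-invol : ∀ v → m (m v) ≡ v
    m-invol v with remove-cases v
    ... | inj₁ (_ , eq)        = trans (cong m eq) eq
    ... | inj₂ (inj₁ (_ , eq)) = trans (cong m eq) eq
    ... | inj₂ (inj₂ (v≢y , v≢z , eq)) =
      trans (cong m eq) (trans (update-rest y y z z (mate N) (proj₁ (avoid v≢y v≢z)) (proj₂ (avoid v≢y v≢z)))
                               (invol N v))

    m-adj : ∀ {v} → m v ≢ v → Graph.Adj G v (m v)
    m-adj {v} mv≢v with remove-cases v
    ... | inj₁ (_ , eq)            = ⊥-elim (mv≢v eq)
    ... | inj₂ (inj₁ (_ , eq))     = ⊥-elim (mv≢v eq)
    ... | inj₂ (inj₂ (_ , _ , eq)) =
      subst (Graph.Adj G v) (sym eq) (adj N (λ p → mv≢v (trans eq p)))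

    remove : Mate G
    remove = record { mate = m ; invol = m-invol ; adj = m-adj }

    remove-fst : mate remove y ≡ y
    remove-fst = update-fst y y z z (mate N)

    remove-snd : mate remove z ≡ z
    remove-snd = update-snd y y z z (mate N) Ny≢y

    remove-fix : ∀ {v} → mate N v ≡ v → mate remove v ≡ v
    remove-fix {v} Nv≡v with remove-cases v
    ... | inj₁ (_ , eq)            = eq
    ... | inj₂ (inj₁ (_ , eq))     = eq
    ... | inj₂ (inj₂ (_ , _ , eq)) = trans eq Nv≡v

    cov-remove : cov N ≡ cov remove + 2
    cov-remove = trans (sum-cong-≗ pointwise)
      (trans (∑-distrib-+ (covered m) (λ v → δ y v + δ z v)) (cong (cov remove +_) (∑-δ+δ y z)))
      where
      pointwise : ∀ v → covered (mate N) v ≡ covered m v + (δ y v + δ z v)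
      pointwise v with remove-cases v
      ... | inj₁ (refl , eq) =
        trans (covered-move (mate N) Ny≢y)
              (sym (cong₂ _+_ (covered-fix m eq) (cong₂ _+_ (δ-refl y) (δ-≢ Ny≢y))))
      ... | inj₂ (inj₁ (refl , eq)) =
        trans (covered-move (mate N) (λ p → Ny≢y (trans (sym p) (invol N y))))
              (sym (cong₂ _+_ (covered-fix m eq) (cong₂ _+_ (δ-≢ (Ny≢y ∘ sym)) (δ-refl z))))
      ... | inj₂ (inj₂ (v≢y , v≢z , eq)) =
        trans (covered-cong (mate N) m (sym eq))
              (trans (sym (+-identityʳ _))
                     (cong (covered m v +_) (sym (cong₂ _+_ (δ-≢ (v≢y ∘ sym)) (δ-≢ (v≢z ∘ sym))))))

-- The field `lo<hi` is irrelevant, so the inequality is decided afresh to obtain a proof that can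
-- be used.
lo≢hi : ∀ {n} (e : Edge n) → lo e ≢ hi e
lo≢hi (edge u v u<v) u≡v with u Fin.<? v
... | yes u<v′ = Fin.<⇒≢ u<v′ u≡v
... | no ¬u<v  = Irrelevant.⊥-elim (¬u<v u<v)

-- Passing between involutions and lists of disjoint edges.

module _ {n} {G : Graph n} where

  -- The last component carries the induction: the ends of the next edge avoid all earlier edges,
  -- hence are still fixed and can be joined.
  fromList : ∀ M → IsMatching G M →
             ∃[ N ] (cov {G = G} N ≡ 2 * length M × (∀ v → All (λ e → v ≢ lo e × v ≢ hi e) M → mate N v ≡ v))
  fromList [] _ =
      record { mate = λ v → v ; invol = λ _ → refl ; adj = λ v≢v → ⊥-elim (v≢v refl) }
    , trans (sum-cong-≗ {n} (λ v → covered-fix (λ v → v) {v} refl)) (sum-replicate-zero n)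
    , λ _ _ → refl
  fromList (e ∷ M) (e∈G ∷ M⊆G , e-disj ∷ M-disj) with fromList M (M⊆G , M-disj)
  ... | N , covN , fixed =
    add , trans cov-add (trans (cong (_+ 2) covN) (lemma (length M)))
    , λ { v ((v≢lo , v≢hi) ∷ rest) → trans (add-rest v≢lo v≢hi) (fixed v rest) }
    where
    open Add N (fixed (lo e) (All.map proj₁ e-disj)) (fixed (hi e) (All.map proj₂ e-disj)) e∈G
    lemma : ∀ l → 2 * l + 2 ≡ 2 * suc l
    lemma = solve-∀

  toEdge : ∀ (N : Mate G) v → mate N v ≢ v →
           ∃[ e ] (mate N (lo e) ≡ hi e × (lo e ≡ v × hi e ≡ mate N v ⊎ lo e ≡ mate N v × hi e ≡ v))
  toEdge N v Nv≢v with Fin.<-cmp v (mate N v)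
  ... | tri< v<Nv _ _ = edge v (mate N v) v<Nv , refl , inj₁ (refl , refl)
  ... | tri≈ _ v≡Nv _ = ⊥-elim (Nv≢v (sym v≡Nv))
  ... | tri> _ _ v>Nv = edge (mate N v) v v>Nv , invol N v , inj₂ (refl , refl)

  private
    -- Edges are peeled off one at a time. The last component gives disjointness: the ends of the
    -- removed edge are fixed by the remaining involution, whereas the ends of every later edge are
    -- moved by it.
    toList′ : (N : Mate G) → Acc _<_ (cov N) →
              ∃[ M ] (IsMatching G M × cov N ≡ 2 * length M × All (λ e → mate N (lo e) ≡ hi e) M)
    toList′ N (acc rs) with Fin.any? (λ v → ¬? (mate N v ≟ v))
    ... | no all-fixed =
      [] , ([] , []) , trans (sum-cong-≗ λ v → fixed v) (sum-replicate-zero n) , []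
      where
      fixed : ∀ v → covered (mate N) v ≡ 0
      fixed v with mate N v ≟ v
      ... | yes _ = refl
      ... | no p  = ⊥-elim (all-fixed (v , p))
    ... | yes (y , Ny≢y) with toList′ remove (rs (subst (cov remove <_) (sym cov-remove) (m<m+n _ (s≤s z≤n))))
                            | toEdge N y Ny≢y
      where open Remove N Ny≢y
    ... | M , (M⊆G , M-disj) , covM , onM | e , Nlo , ends =
      e ∷ M
      , (subst (Graph.Adj G (lo e)) Nlo (adj N (λ p → lo≢hi e (trans (sym p) Nlo))) ∷ M⊆G
        , All.map (λ {f} → disj {f}) onM ∷ M-disj)
      , trans cov-remove (trans (cong (_+ 2) covM) (lemma (length M)))
      , Nlo ∷ All.map (λ {f} → on-N {f}) onM
      where
      open Remove N Ny≢y
      lemma : ∀ l → 2 * l + 2 ≡ 2 * suc l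
      lemma = solve-∀
      moves : ∀ f → mate remove (lo f) ≡ hi f → ∀ {v} → v ≡ lo f ⊎ v ≡ hi f → mate remove v ≢ v
      moves f eq (inj₁ refl) p = lo≢hi f (trans (sym p) eq)
      moves f eq (inj₂ refl) p = lo≢hi f (trans (trans (sym (invol remove (lo f))) (cong (mate remove) eq)) p)
      fixed-at : ∀ {v w} → mate remove w ≡ w → v ≡ w → mate remove v ≡ v
      fixed-at w-fixed refl = w-fixed
      fixes : ∀ {v} → v ≡ lo e ⊎ v ≡ hi e → mate remove v ≡ v
      fixes (inj₁ p) = fixed-at ([ (λ (l , _) → fixed-at remove-fst l) , (λ (l , _) → fixed-at remove-snd l) ]′ ends) p
      fixes (inj₂ p) = fixed-at ([ (λ (_ , h) → fixed-at remove-snd h) , (λ (_ , h) → fixed-at remove-fst h) ]′ ends) p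
      disj : ∀ {f} → mate remove (lo f) ≡ hi f → Disjoint e f
      disj {f} eq =
          ((λ p → moves f eq (inj₁ p) (fixes (inj₁ refl))) , (λ p → moves f eq (inj₂ p) (fixes (inj₁ refl))))
        , ((λ p → moves f eq (inj₁ p) (fixes (inj₂ refl))) , (λ p → moves f eq (inj₂ p) (fixes (inj₂ refl))))
      on-N : ∀ {f} → mate remove (lo f) ≡ hi f → mate N (lo f) ≡ hi f
      on-N {f} eq with remove-cases (lo f)
      ... | inj₁ (_ , p)            = ⊥-elim (lo≢hi f (trans (sym p) eq))
      ... | inj₂ (inj₁ (_ , p))     = ⊥-elim (lo≢hi f (trans (sym p) eq))
      ... | inj₂ (inj₂ (_ , _ , p)) = trans (sym p) eq

  toList : (N : Mate G) → ∃[ M ] (IsMatching G M × cov N ≡ 2 * length M)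
  toList N with toList′ N (<-wellFounded _)
  ... | M , matching , eq , _ = M , matching , eq

-- μ is kept opaque, because with-abstraction would otherwise normalise the exhaustive search.
opaque
  ν : ∀ {n} → Graph n → ℕ
  ν = μ

  ν≡μ : ∀ {n} (G : Graph n) → ν G ≡ μ G
  ν≡μ G = refl

  cov≤2ν : ∀ {n} {G : Graph n} (N : Mate G) → cov N ≤ 2 * ν G
  cov≤2ν {G = G} N with toList N
  ... | M , matching , eq = subst (_≤ 2 * μ G) (sym eq) (*-monoʳ-≤ 2 (μ-upper G M matching))

  maximumMate : ∀ {n} {G : Graph n} → ∃[ N ] cov {G = G} N ≡ 2 * ν G
  maximumMate {G = G} with μ-attained G
  ... | M , matching , len with fromList M matching
  ... | N , eq , _ = N , trans eq (cong (2 *_) len)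

-- Exchange between two maximum matchings.

module _ {n} {G : Graph n} where

  diff : (N N′ : Mate G) → Fin n → ℕ
  diff N N′ v = 1 ∸ δ (mate N v) (mate N′ v)

  maximum-augment : ∀ (N : Mate G) → cov N ≡ 2 * ν G → ∀ {a b} → mate N a ≡ a → mate N b ≡ b →
                    ¬ Graph.Adj G a b
  maximum-augment N max Na≡a Nb≡b a~b =
    <-irrefl refl (<-≤-trans (m<m+n (cov N) (s≤s z≤n))
      (≤-trans (≤-reflexive (sym cov-add)) (≤-trans (cov≤2ν add) (≤-reflexive (sym max)))))
    where open Add N Na≡a Nb≡b a~b

  -- The step of Gallai's lemma: exchanging edges moves N′ towards N, with t still missed,
  -- until N′ misses one of the vertices u, v missed by N.
  private
    exchange′ : ∀ (N N′ : Mate G) → Acc _<_ (sum (diff N N′)) → cov N ≡ 2 * ν G → cov N′ ≡ 2 * ν G →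
                ∀ {u v t} → u ≢ v → mate N u ≡ u → mate N v ≡ v → mate N′ t ≡ t →
                ∃[ P ] (cov {G = G} P ≡ 2 * ν G × mate P t ≡ t × (mate P u ≡ u ⊎ mate P v ≡ v))
    exchange′ N N′ (acc rs) maxN maxN′ {u} {v} {t} u≢v Nu≡u Nv≡v N′t≡t
      with mate N′ u ≟ u | mate N′ v ≟ v
    ... | yes N′u≡u | _ = N′ , maxN′ , N′t≡t , inj₁ N′u≡u
    ... | no _ | yes N′v≡v = N′ , maxN′ , N′t≡t , inj₂ N′v≡v
    ... | no N′u≢u | no N′v≢v
      with Fin.any? (λ x → ¬? (mate N x ≟ x) ×-dec (mate N′ x ≟ x) ×-dec ¬? (x ≟ t))
    -- Now `N′` covers all that `N` covers, except possibly `t`, and covers `u` and `v` in addition.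
    -- This makes `N′` larger than `N`, although both are maximum.
    ... | no none = ⊥-elim (<-irrefl refl (<-≤-trans (+-monoʳ-< (cov N) (s≤s (s≤s z≤n))) count))
      where
      pointwise : ∀ x → covered (mate N) x + (δ u x + δ v x) ≤ covered (mate N′) x + δ t x
      pointwise x with x ≟ u | x ≟ v
      ... | yes refl | yes refl = ⊥-elim (u≢v refl)
      ... | yes refl | no x≢v
        rewrite covered-fix (mate N) Nu≡u | covered-move (mate N′) N′u≢u | δ-refl u | δ-≢ (x≢v ∘ sym)
        = s≤s z≤n
      ... | no x≢u | yes refl
        rewrite covered-fix (mate N) Nv≡v | covered-move (mate N′) N′v≢v | δ-refl v | δ-≢ (x≢u ∘ sym)
        = s≤s z≤n
      ... | no x≢u | no x≢v rewrite δ-≢ (x≢u ∘ sym) | δ-≢ (x≢v ∘ sym) | +-identityʳ (covered (mate N) x)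
        with mate N x ≟ x | mate N′ x ≟ x | x ≟ t
      ... | yes _ | _ | _ = z≤n
      ... | no _ | no _ | _ = s≤s z≤n
      ... | no _ | yes _ | yes refl rewrite δ-refl x = s≤s z≤n
      ... | no p | yes q | no r = ⊥-elim (none (x , p , q , r))
      count : cov N + 2 ≤ cov N + 1
      count = begin
        cov N + 2
          ≡⟨ cong (cov N +_) (∑-δ+δ u v) ⟨
        cov N + sum (λ x → δ u x + δ v x)
          ≡⟨ ∑-distrib-+ (covered (mate N)) (λ x → δ u x + δ v x) ⟨
        sum (λ x → covered (mate N) x + (δ u x + δ v x))
          ≤⟨ sum-mono-≤ pointwise ⟩
        sum (λ x → covered (mate N′) x + δ t x)
          ≡⟨ ∑-distrib-+ (covered (mate N′)) (δ t) ⟩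
        cov N′ + sum (δ t)
          ≡⟨ cong₂ _+_ (trans maxN′ (sym maxN)) (∑-δ₁ t) ⟩
        cov N + 1 ∎
        where open ≤-Reasoning
    ... | yes (x , Nx≢x , N′x≡x , x≢t) with mate N′ (mate N x) ≟ mate N x
    ... | yes N′y≡y = ⊥-elim (maximum-augment N′ maxN′ N′x≡x N′y≡y (adj N Nx≢x))
    -- The edge of `N′` at `y` is replaced by the edge `x y` of `N`. The size is unchanged, and `t`
    -- stays missed: it differs from `x` by choice and from `y` because `N′` covers `y`.
    ... | no N′y≢y = exchange′ N P (rs closer) maxN maxP u≢v Nu≡u Nv≡v Pt≡t
      where
      y = mate N x
      open Remove N′ N′y≢y
      z≢x : mate N′ y ≢ x
      z≢x z≡x = Nx≢x (trans (sym (invol N′ y)) (trans (cong (mate N′) z≡x) N′x≡x))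
      open Add remove (remove-fix N′x≡x) remove-fst (adj N Nx≢x)
      P : Mate G
      P = add
      maxP : cov P ≡ 2 * ν G
      maxP = trans cov-add (trans (sym cov-remove) maxN′)
      t≢y : t ≢ y
      t≢y t≡y = N′y≢y (subst (λ w → mate N′ w ≡ w) t≡y N′t≡t)
      Pt≡t : mate P t ≡ t
      Pt≡t = trans (add-rest (x≢t ∘ sym) t≢y) (remove-fix N′t≡t)
      diff≡0 : ∀ {w} → mate P w ≡ mate N w → diff N P w ≡ 0
      diff≡0 {w} eq rewrite eq | δ-refl (mate N w) = refl
      diff≡1 : ∀ {w} → mate N w ≢ mate N′ w → diff N N′ w ≡ 1
      diff≡1 neq rewrite δ-≢ neq = refl
      pointwise : ∀ w → diff N P w ≤ diff N N′ w
      pointwise w with add-cases w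
      ... | inj₁ (refl , eq) rewrite diff≡0 eq = z≤n
      ... | inj₂ (inj₁ (_ , refl , eq)) rewrite diff≡0 (trans eq (sym (invol N x))) = z≤n
      ... | inj₂ (inj₂ (w≢x , w≢y , eq)) with remove-cases w
      ...   | inj₁ (w≡y , _) = ⊥-elim (w≢y w≡y)
      ...   | inj₂ (inj₂ (_ , _ , eq′)) = ≤-reflexive (cong (λ p → 1 ∸ δ (mate N w) p) (trans eq eq′))
      -- Only the former partner of `y`, now unmatched, could be a new disagreement, but `N` and
      -- `N′` already disagreed there, since `N` matches `y` to `x`.
      ...   | inj₂ (inj₁ (refl , _)) =
        subst (diff N P w ≤_) (sym (diff≡1 Nz≢y)) (m∸n≤m 1 (δ (mate N w) (mate P w)))
        where
        Nz≢y : mate N w ≢ mate N′ w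
        Nz≢y p = z≢x (trans (sym (invol N w)) (trans (cong (mate N) (trans p (invol N′ y))) (invol N x)))
      closer : sum (diff N P) < sum (diff N N′)
      closer = sum-mono-< pointwise x
        (subst₂ _<_ (sym (diff≡0 add-fst)) (sym (diff≡1 (λ p → Nx≢x (trans p N′x≡x)))) (s≤s z≤n))

  exchange : ∀ (N N′ : Mate G) → cov N ≡ 2 * ν G → cov N′ ≡ 2 * ν G →
             ∀ {u v t} → u ≢ v → mate N u ≡ u → mate N v ≡ v → mate N′ t ≡ t →
             ∃[ P ] (cov {G = G} P ≡ 2 * ν G × mate P t ≡ t × (mate P u ≡ u ⊎ mate P v ≡ v))
  exchange N N′ = exchange′ N N′ (<-wellFounded _)

-- Induced subgraphs and the deletion of vertices.

module _ {n : ℕ} where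

  _∣_ : Graph n → (Fin n → Bool) → Graph n
  G ∣ W = record
    { Adj    = λ u v → W u ≡ true × W v ≡ true × Adj u v
    ; symm   = λ (Wu , Wv , u~v) → Wv , Wu , symm u~v
    ; irrefl = λ u≡v (_ , _ , u~v) → irrefl u≡v u~v
    ; adj?   = λ u v → (W u Bool.≟ true) ×-dec (W v Bool.≟ true) ×-dec adj? u v
    }
    where open Graph G

  infixl 6 _─_
  _─_ : (Fin n → Bool) → Fin n → Fin n → Bool
  (W ─ v) x = W x ∧ not (does (x ≟ v))

  ─-removed : ∀ W v → (W ─ v) v ≡ false
  ─-removed W v with v ≟ v
  ... | yes _  = Bool.∧-zeroʳ (W v)
  ... | no v≢v = ⊥-elim (v≢v refl)

  ─-other : ∀ W {v x} → W x ≡ true → x ≢ v → (W ─ v) x ≡ true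
  ─-other W {v} {x} Wx x≢v with x ≟ v
  ... | yes x≡v = ⊥-elim (x≢v x≡v)
  ... | no _ rewrite Wx = refl

  ─-⊆ : ∀ W {v x} → (W ─ v) x ≡ true → W x ≡ true
  ─-⊆ W {x = x} p with W x
  ... | true = refl

  ─-≤ : ∀ W v x → ⟦ (W ─ v) x ⟧ ≤ ⟦ W x ⟧
  ─-≤ W v x with W x | x ≟ v
  ... | true  | yes _ = z≤n
  ... | true  | no _  = ≤-refl
  ... | false | _     = z≤n

  card : (Fin n → Bool) → ℕ
  card W = sum (⟦_⟧ ∘ W)

  retype : ∀ {G G′ : Graph n} (N : Mate G) →
           (∀ {v} → mate N v ≢ v → Graph.Adj G′ v (mate N v)) → Mate G′
  retype N adj′ = record { mate = mate N ; invol = invol N ; adj = adj′ }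

  fixed-outside : ∀ {G : Graph n} {W} (N : Mate (G ∣ W)) {v} → W v ≡ false → mate N v ≡ v
  fixed-outside {W = W} N {v} Wv with mate N v ≟ v
  ... | yes p = p
  ... | no p with () ← trans (sym Wv) (proj₁ (adj N p))

  moved-mate : ∀ {G : Graph n} (N : Mate G) {v} → mate N v ≢ v → mate N (mate N v) ≢ mate N v
  moved-mate N {v} Nv≢v p = Nv≢v (trans (sym p) (invol N v))

  module _ {G : Graph n} {W : Fin n → Bool} where

    -- The comparison of two values of `ν` is a decidable form of "some maximum matching misses
    -- `v`". Deleting an unmatched vertex keeps a matching, and a matching of the smaller graph is
    -- one of the larger, so the two forms are interchangeable.
    missing : ∀ v → ν (G ∣ W) ≤ ν (G ∣ (W ─ v)) →
              ∃[ N ] (cov {G = G ∣ W} N ≡ 2 * ν (G ∣ W) × mate N v ≡ v)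
    missing v ν≤ with maximumMate {G = G ∣ (W ─ v)}
    ... | N , covN = N′ , ≤-antisym (cov≤2ν N′) (subst (2 * ν (G ∣ W) ≤_) (sym covN) (*-monoʳ-≤ 2 ν≤))
                   , fixed-outside N (─-removed W v)
      where
      N′ : Mate (G ∣ W)
      N′ = retype N λ p → let a , b , c = adj N p in ─-⊆ W a , ─-⊆ W b , c

    missing₂ : ∀ u v → ν (G ∣ W) ≤ ν (G ∣ (W ─ u ─ v)) →
               ∃[ N ] (cov {G = G ∣ W} N ≡ 2 * ν (G ∣ W) × mate N u ≡ u × mate N v ≡ v)
    missing₂ u v ν≤ with maximumMate {G = G ∣ (W ─ u ─ v)}
    ... | N , covN = N′ , ≤-antisym (cov≤2ν N′) (subst (2 * ν (G ∣ W) ≤_) (sym covN) (*-monoʳ-≤ 2 ν≤))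
                   , fixed-outside N (cong (_∧ not (does (u ≟ v))) (─-removed W u))
                   , fixed-outside N (─-removed (W ─ u) v)
      where
      N′ : Mate (G ∣ W)
      N′ = retype N λ p → let a , b , c = adj N p in ─-⊆ W (─-⊆ (W ─ u) a) , ─-⊆ W (─-⊆ (W ─ u) b) , c

    missing₂⁻¹ : ∀ u v (N : Mate (G ∣ W)) → cov N ≡ 2 * ν (G ∣ W) → mate N u ≡ u → mate N v ≡ v →
                 ν (G ∣ W) ≤ ν (G ∣ (W ─ u ─ v))
    missing₂⁻¹ u v N covN Nu≡u Nv≡v = *-cancelˡ-≤ 2 (subst (_≤ _) covN (cov≤2ν N′))
      where
      in-W′ : ∀ {x} → W x ≡ true → mate N x ≢ x → (W ─ u ─ v) x ≡ true
      in-W′ {x} Wx Nx≢x = ─-other (W ─ u) (─-other W Wx (λ { refl → Nx≢x Nu≡u })) (λ { refl → Nx≢x Nv≡v })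
      N′ : Mate (G ∣ (W ─ u ─ v))
      N′ = retype N λ p → let a , b , c = adj N p in in-W′ a p , in-W′ b (moved-mate N p) , c

  weight : (Fin n → Bool) → ℕ × Edge n → ℕ
  weight S (w , e) = w * (⟦ S (lo e) ⟧ * ⟦ S (hi e) ⟧)

  inside : (Fin n → Bool) → List (ℕ × Edge n) → ℕ
  inside S = ∑ˡ (weight S)

  degree : List (ℕ × Edge n) → Fin n → ℕ
  degree E v = ∑ˡ (λ (w , e) → w * (δ (lo e) v + δ (hi e) v)) E

-- Gallai classes in a graph without essential vertices.

2*⌊n/2⌋≤n : ∀ n → 2 * ⌊ n /2⌋ ≤ n
2*⌊n/2⌋≤n n = begin
  ⌊ n /2⌋ + (⌊ n /2⌋ + 0) ≡⟨ cong (⌊ n /2⌋ +_) (+-identityʳ _) ⟩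
  ⌊ n /2⌋ + ⌊ n /2⌋       ≤⟨ +-monoʳ-≤ ⌊ n /2⌋ (⌊n/2⌋≤⌈n/2⌉ n) ⟩
  ⌊ n /2⌋ + ⌈ n /2⌉       ≡⟨ ⌊n/2⌋+⌈n/2⌉≡n n ⟩
  n ∎
  where open ≤-Reasoning

halve-≤ : ∀ c t w → c + 2 * t ≤ 2 * w + 1 → ⌊ c /2⌋ + t ≤ w
halve-≤ c t w h = m<1+n⇒m≤n (*-cancelˡ-< 2 _ _ (begin-strict
  2 * (⌊ c /2⌋ + t)     ≡⟨ *-distribˡ-+ 2 ⌊ c /2⌋ t ⟩
  2 * ⌊ c /2⌋ + 2 * t   ≤⟨ +-monoˡ-≤ (2 * t) (2*⌊n/2⌋≤n c) ⟩
  c + 2 * t             ≤⟨ h ⟩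
  2 * w + 1             <⟨ +-monoʳ-< (2 * w) (s≤s (s≤s z≤n)) ⟩
  2 * w + 2             ≡⟨ lemma w ⟩
  2 * suc w ∎))
  where
  open ≤-Reasoning
  lemma : ∀ w → 2 * w + 2 ≡ 2 * suc w
  lemma = solve-∀

-- Gallai's decomposition: if no vertex of W is essential, then the vertices
-- that no maximum matching misses together with v form a class S that is
-- closed under adjacency, and a maximum matching missing v covers S ∖ {v}.
module Class {n} (G : Graph n) (W : Fin n → Bool)
             (inessential : ∀ {v} → W v ≡ true → ν (G ∣ W) ≤ ν (G ∣ (W ─ v)))
             {v} (v∈W : W v ≡ true) where

  opaque
    related : ∀ u → Dec (u ≡ v ⊎ ν (G ∣ (W ─ v ─ u)) < ν (G ∣ W))
    related u = (u ≟ v) ⊎-dec (ν (G ∣ (W ─ v ─ u)) <? ν (G ∣ W))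

  S T : Fin n → Bool
  S u = W u ∧ does (related u)
  T u = W u ∧ not (does (related u))

  T⇒W : ∀ {u} → T u ≡ true → W u ≡ true
  T⇒W {u} p with W u
  ... | true = refl

  S⇒¬T : ∀ {u} → S u ≡ true → T u ≡ false
  S⇒¬T {u} p with W u | does (related u)
  ... | true | true = refl

  T⇒¬S : ∀ {u} → T u ≡ true → S u ≡ false
  T⇒¬S {u} p with W u | does (related u)
  ... | true | false = refl

  ¬S⇒T : ∀ {u} → W u ≡ true → S u ≡ false → T u ≡ true
  ¬S⇒T {u} _ _ with W u | does (related u)
  ... | true | false = refl

  S⇒related : ∀ {u} → S u ≡ true → u ≡ v ⊎ ν (G ∣ (W ─ v ─ u)) < ν (G ∣ W)
  S⇒related {u} p with W u | related u
  ... | true | yes r = r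
  S⇒related {u} () | true | no _
  S⇒related {u} () | false | _

  T⇒unrelated : ∀ {u} → T u ≡ true → u ≢ v × ν (G ∣ W) ≤ ν (G ∣ (W ─ v ─ u))
  T⇒unrelated {u} p with W u | related u
  ... | true | no r = (λ e → r (inj₁ e)) , ≮⇒≥ (λ l → r (inj₂ l))
  T⇒unrelated {u} () | true | yes _
  T⇒unrelated {u} () | false | _

  v∈S : S v ≡ true
  v∈S = cong₂ _∧_ v∈W (dec-true (related v) (inj₁ refl))

  -- If `w` were outside, some maximum matching `N` would miss both `v` and `w`. For `u` equal to
  -- `v` the edge `u w` augments `N`. Otherwise `exchange`, applied to `N` and a maximum matching
  -- missing `u`, yields one that misses `u` together with `v`, against the choice of `u`, or
  -- together with `w`, where `u w` augments it.
  closed : ∀ {u w} → S u ≡ true → Graph.Adj (G ∣ W) u w → S w ≡ true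
  closed {u} {w} Su u~w with S w in Sw
  ... | true  = refl
  ... | false with T⇒unrelated (¬S⇒T (proj₁ (proj₂ u~w)) Sw)
  ... | w≢v , ν≤ with missing₂ v w ν≤
  ... | N , covN , Nv≡v , Nw≡w with S⇒related Su
  ... | inj₁ refl = ⊥-elim (maximum-augment N covN Nv≡v Nw≡w u~w)
  ... | inj₂ ν< with missing u (inessential (proj₁ u~w))
  ... | N′ , covN′ , N′u≡u with exchange N N′ covN covN′ (w≢v ∘ sym) Nv≡v Nw≡w N′u≡u
  ... | P , covP , Pu≡u , inj₁ Pv≡v = ⊥-elim (<⇒≱ ν< (missing₂⁻¹ v u P covP Pv≡v Pu≡u))
  ... | P , covP , Pu≡u , inj₂ Pw≡w = ⊥-elim (maximum-augment P covP Pu≡u Pw≡w u~w)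

  -- A maximum matching `N` missing `v` covers the rest of `S`, by definition of the class, and maps
  -- `S` to itself, by `closed`. Hence it can be glued to a maximum matching of the rest `T`. The
  -- single vertex `v` lost in the count is absorbed by rounding down.
  ν-split : ⌊ card S /2⌋ + ν (G ∣ T) ≤ ν (G ∣ W)
  ν-split with missing v (inessential v∈W) | maximumMate {G = G ∣ T}
  ... | N , covN , Nv≡v | P , covP = halve-≤ (card S) (ν (G ∣ T)) (ν (G ∣ W)) (begin
    card S + 2 * ν (G ∣ T)                    ≡⟨ cong (card S +_) covP ⟨
    card S + cov P                            ≡⟨ ∑-distrib-+ (⟦_⟧ ∘ S) (covered (mate P)) ⟨
    sum (λ x → ⟦ S x ⟧ + covered (mate P) x)  ≤⟨ sum-mono-≤ pointwise ⟩
    sum (λ x → covered m x + δ v x)           ≡⟨ ∑-distrib-+ (covered m) (δ v) ⟩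
    sum (covered m) + sum (δ v)               ≡⟨ cong (sum (covered m) +_) (∑-δ₁ v) ⟩
    cov Q + 1                                 ≤⟨ +-monoˡ-≤ 1 (cov≤2ν Q) ⟩
    2 * ν (G ∣ W) + 1 ∎)
    where
    open ≤-Reasoning
    m : Fin n → Fin n
    m x = if S x then mate N x else mate P x
    m-S : ∀ {x} → S x ≡ true → m x ≡ mate N x
    m-S Sx rewrite Sx = refl
    m-¬S : ∀ {x} → S x ≡ false → m x ≡ mate P x
    m-¬S Sx rewrite Sx = refl
    S-mate : ∀ {x} → S x ≡ true → S (mate N x) ≡ true
    S-mate {x} Sx with mate N x ≟ x
    ... | yes p = trans (cong S p) Sx
    ... | no p  = closed Sx (adj N p)
    ¬S-mate : ∀ {x} → S x ≡ false → S (mate P x) ≡ false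
    ¬S-mate {x} Sx with mate P x ≟ x
    ... | yes p = trans (cong S p) Sx
    ... | no p  = T⇒¬S (proj₁ (proj₂ (adj P p)))
    m-invol : ∀ x → m (m x) ≡ x
    m-invol x with S x in Sx
    ... | true  = trans (m-S (S-mate Sx)) (invol N x)
    ... | false = trans (m-¬S (¬S-mate Sx)) (invol P x)
    m-adj : ∀ {x} → m x ≢ x → Graph.Adj (G ∣ W) x (m x)
    m-adj {x} mx≢x with S x in Sx
    ... | true  = adj N mx≢x
    ... | false = let a , b , c = adj P mx≢x in T⇒W a , T⇒W b , c
    Q : Mate (G ∣ W)
    Q = record { mate = m ; invol = m-invol ; adj = m-adj }
    outside : ∀ {x} → S x ≡ false → covered (mate P) x ≤ covered m x + δ v x
    outside {x} Sx = ≤-trans (≤-reflexive (covered-cong (mate P) m (sym (m-¬S Sx)))) (m≤m+n (covered m x) (δ v x))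
    within : ∀ {x} → S x ≡ true → 1 ≤ covered m x + δ v x
    within {x} Sx with mate N x ≟ x
    ... | no Nx≢x =
      ≤-trans (≤-reflexive (sym (covered-move m (λ p → Nx≢x (trans (sym (m-S Sx)) p))))) (m≤m+n (covered m x) (δ v x))
    ... | yes Nx≡x with S⇒related Sx
    ...   | inj₁ refl = ≤-trans (≤-reflexive (sym (δ-refl v))) (m≤n+m (δ v v) (covered m v))
    ...   | inj₂ ν<   = ⊥-elim (<⇒≱ ν< (missing₂⁻¹ v x N covN Nv≡v Nx≡x))
    pointwise : ∀ x → ⟦ S x ⟧ + covered (mate P) x ≤ covered m x + δ v x
    pointwise x with S x Bool.≟ true
    ... | yes Sx = subst (_≤ covered m x + δ v x)
      (sym (cong₂ _+_ (cong ⟦_⟧ Sx) (covered-fix (mate P) (fixed-outside P (S⇒¬T Sx))))) (within Sx)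
    ... | no ¬Sx = subst (λ b → ⟦ b ⟧ + covered (mate P) x ≤ covered m x + δ v x) (sym Sx) (outside Sx)
      where Sx = Bool.¬-not ¬Sx

  card-T<card-W : card T < card W
  card-T<card-W = sum-mono-< T≤W v (subst₂ _<_ (sym (cong ⟦_⟧ (S⇒¬T v∈S))) (sym (cong ⟦_⟧ v∈W)) (s≤s z≤n))
    where
    T≤W : ∀ x → ⟦ T x ⟧ ≤ ⟦ W x ⟧
    T≤W x with W x | does (related x)
    ... | true  | true  = z≤n
    ... | true  | false = ≤-refl
    ... | false | _     = z≤n

  -- No edge of `G` joins `S` to `T`, because `S` is closed under adjacency.
  inside-split : ∀ E → All (λ (_ , e) → e ∈E G) E → inside W E ≤ inside S E + inside T E
  inside-split E E⊆G = begin
    ∑ˡ (weight W) E                          ≤⟨ ∑ˡ-mono (All.map (λ {we} → split {we}) E⊆G) ⟩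
    ∑ˡ (λ we → weight S we + weight T we) E  ≡⟨ ∑ˡ-distrib-+ (weight S) (weight T) E ⟩
    inside S E + inside T E ∎
    where
    open ≤-Reasoning
    same-side : ∀ {x y} → Graph.Adj G x y → W x ≡ true → W y ≡ true →
                (S x ≡ true × S y ≡ true) ⊎ (T x ≡ true × T y ≡ true)
    same-side {x} {y} x~y Wx Wy with S x Bool.≟ true | S y Bool.≟ true
    ... | yes Sx | _      = inj₁ (Sx , closed Sx (Wx , Wy , x~y))
    ... | no ¬Sx | yes Sy = ⊥-elim (¬Sx (closed Sy (Wy , Wx , Graph.symm G x~y)))
    ... | no ¬Sx | no ¬Sy = inj₂ (¬S⇒T Wx (Bool.¬-not ¬Sx) , ¬S⇒T Wy (Bool.¬-not ¬Sy))
    split : ∀ {we : ℕ × Edge n} → let w , e = we in e ∈E G →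
            w * (⟦ W (lo e) ⟧ * ⟦ W (hi e) ⟧)
              ≤ w * (⟦ S (lo e) ⟧ * ⟦ S (hi e) ⟧) + w * (⟦ T (lo e) ⟧ * ⟦ T (hi e) ⟧)
    split {w , e} e∈G with W (lo e) Bool.≟ true | W (hi e) Bool.≟ true
    ... | no ¬Wl | _ rewrite Bool.¬-not ¬Wl = ≤-trans (≤-reflexive (*-zeroʳ w)) z≤n
    ... | yes Wl | no ¬Wh rewrite Wl | Bool.¬-not ¬Wh = ≤-trans (≤-reflexive (*-zeroʳ w)) z≤n
    ... | yes Wl | yes Wh with same-side e∈G Wl Wh
    ...   | inj₁ (Sl , Sh) = ≤-trans
      (≤-reflexive (cong₂ (λ a b → w * (⟦ a ⟧ * ⟦ b ⟧)) (trans Wl (sym Sl)) (trans Wh (sym Sh))))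
      (m≤m+n (w * (⟦ S (lo e) ⟧ * ⟦ S (hi e) ⟧)) _)
    ...   | inj₂ (Tl , Th) = ≤-trans
      (≤-reflexive (cong₂ (λ a b → w * (⟦ a ⟧ * ⟦ b ⟧)) (trans Wl (sym Tl)) (trans Wh (sym Th))))
      (m≤n+m (w * (⟦ T (lo e) ⟧ * ⟦ T (hi e) ⟧)) _)

-- Bounding a fractional matching by a maximum matching.

module _ {n} (G : Graph n) (E : List (ℕ × Edge n)) (E⊆G : All (λ (_ , e) → e ∈E G) E) (A B : ℕ)
         (odd-sets : ∀ S → A * inside S E ≤ B * ⌊ card S /2⌋)
         (degrees : ∀ v → A * degree E v ≤ B) where

  private
    inside-─ : ∀ W v → inside W E ≤ inside (W ─ v) E + degree E v
    inside-─ W v = ≤-trans (∑ˡ-mono (All.universal (λ (w , e) → pointwise w e) E))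
                           (≤-reflexive (∑ˡ-distrib-+ (weight (W ─ v)) _ E))
      where
      pointwise : ∀ w (e : Edge n) → w * (⟦ W (lo e) ⟧ * ⟦ W (hi e) ⟧)
                  ≤ w * (⟦ (W ─ v) (lo e) ⟧ * ⟦ (W ─ v) (hi e) ⟧) + w * (δ (lo e) v + δ (hi e) v)
      pointwise w e rewrite sym (*-distribˡ-+ w (⟦ (W ─ v) (lo e) ⟧ * ⟦ (W ─ v) (hi e) ⟧) (δ (lo e) v + δ (hi e) v))
        = *-monoʳ-≤ w bound
        where
        bound : ⟦ W (lo e) ⟧ * ⟦ W (hi e) ⟧
                ≤ ⟦ (W ─ v) (lo e) ⟧ * ⟦ (W ─ v) (hi e) ⟧ + (δ (lo e) v + δ (hi e) v)
        bound with W (lo e) | W (hi e) | lo e ≟ v | hi e ≟ v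
        ... | false | _ | _ | _ = z≤n
        ... | true | false | _ | _ = z≤n
        ... | true | true | yes _ | _ = s≤s z≤n
        ... | true | true | no _ | yes _ = s≤s z≤n
        ... | true | true | no _ | no _ = s≤s z≤n

    -- Each case of the induction spends one hypothesis. Deleting an essential vertex loses weight
    -- at most its degree, and `ν` drops by at least one. Splitting off a class `S` loses what
    -- `odd-sets` allows, and `ν-split` returns as much.
    inside≤ν : ∀ W → Acc _<_ (card W) → A * inside W E ≤ B * ν (G ∣ W)
    inside≤ν W (acc rs) with Fin.any? (λ v → (W v Bool.≟ true) ×-dec (ν (G ∣ (W ─ v)) <? ν (G ∣ W)))
    ... | yes (v , v∈W , ν<) = begin
      A * inside W E                             ≤⟨ *-monoʳ-≤ A (inside-─ W v) ⟩
      A * (inside (W ─ v) E + degree E v)        ≡⟨ *-distribˡ-+ A _ _ ⟩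
      A * inside (W ─ v) E + A * degree E v      ≤⟨ +-mono-≤ (inside≤ν (W ─ v) (rs smaller)) (degrees v) ⟩
      B * ν (G ∣ (W ─ v)) + B                    ≡⟨ +-comm _ B ⟩
      B + B * ν (G ∣ (W ─ v))                    ≡⟨ *-suc B _ ⟨
      B * suc (ν (G ∣ (W ─ v)))                  ≤⟨ *-monoʳ-≤ B ν< ⟩
      B * ν (G ∣ W) ∎
      where
      open ≤-Reasoning
      smaller : card (W ─ v) < card W
      smaller = sum-mono-< (─-≤ W v) v
        (subst₂ _<_ (sym (cong ⟦_⟧ (─-removed W v))) (sym (cong ⟦_⟧ v∈W)) (s≤s z≤n))
    ... | no none with Fin.any? (λ v → W v Bool.≟ true)
    ... | yes (v , v∈W) = begin
      A * inside W E                             ≤⟨ *-monoʳ-≤ A (inside-split E E⊆G) ⟩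
      A * (inside S E + inside T E)              ≡⟨ *-distribˡ-+ A _ _ ⟩
      A * inside S E + A * inside T E            ≤⟨ +-mono-≤ (odd-sets S) (inside≤ν T (rs card-T<card-W)) ⟩
      B * ⌊ card S /2⌋ + B * ν (G ∣ T)           ≡⟨ *-distribˡ-+ B _ _ ⟨
      B * (⌊ card S /2⌋ + ν (G ∣ T))             ≤⟨ *-monoʳ-≤ B ν-split ⟩
      B * ν (G ∣ W) ∎
      where
      open ≤-Reasoning
      open Class G W (λ {v} v∈W → ≮⇒≥ (λ ν< → none (v , v∈W , ν<))) v∈W
    ... | no empty = ≤-trans (*-monoʳ-≤ A (∑ˡ-mono (All.universal (λ (w , e) → zero-term w e) E)))
                             (subst (_≤ B * ν (G ∣ W)) (sym A*0≡0) z≤n)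
      where
      A*0≡0 : A * ∑ˡ (λ _ → 0) E ≡ 0
      A*0≡0 = trans (cong (A *_) (trans (∑ˡ-const 0 E) (*-zeroʳ (length E)))) (*-zeroʳ A)
      zero-term : ∀ w (e : Edge n) → w * (⟦ W (lo e) ⟧ * ⟦ W (hi e) ⟧) ≤ 0
      zero-term w e with W (lo e) in Wl
      ... | false = ≤-reflexive (*-zeroʳ w)
      ... | true  = ⊥-elim (empty (lo e , Wl))

  -- Edmonds' matching polytope, up to the factor B / A.
  fractional≤μ : A * ∑ˡ proj₁ E ≤ B * μ G
  fractional≤μ = begin
    A * ∑ˡ proj₁ E           ≡⟨ cong (A *_) (∑ˡ-cong (λ (w , e) → sym (*-identityʳ w)) E) ⟩
    A * inside everything E  ≤⟨ inside≤ν everything (<-wellFounded _) ⟩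
    B * ν (G ∣ everything)   ≤⟨ *-monoʳ-≤ B ν≤ ⟩
    B * ν G                  ≡⟨ cong (B *_) (ν≡μ G) ⟩
    B * μ G ∎
    where
    open ≤-Reasoning
    everything : Fin n → Bool
    everything _ = true
    ν≤ : ν (G ∣ everything) ≤ ν G
    ν≤ with maximumMate {G = G ∣ everything}
    ... | N , covN = *-cancelˡ-≤ 2 (subst (_≤ 2 * ν G) covN (cov≤2ν {G = G} (retype N λ p → proj₂ (proj₂ (adj N p)))))

-- Degrees, multiplicities and the weight inside a vertex set.

module _ {n : ℕ} where

  weigh : (Edge n → ℕ) → List (Edge n) → List (ℕ × Edge n)
  weigh w = map (λ e → w e , e)

  ones : List (Edge n) → List (ℕ × Edge n)
  ones = weigh (λ _ → 1)

  deg : List (Edge n) → Fin n → ℕ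
  deg E = degree (ones E)

  multiplicity : List (Edge n) → Fin n → Fin n → ℕ
  multiplicity E u v = ∑ˡ (λ e → δ (lo e) u * δ (hi e) v) E

  multiplicity⇒∈ : ∀ E {u v} → 1 ≤ multiplicity E u v → ∃[ e ] (e ∈ E × lo e ≡ u × hi e ≡ v)
  multiplicity⇒∈ (e ∷ E) {u} {v} h with lo e ≟ u | hi e ≟ v
  ... | yes l | yes h = e , here refl , l , h
  ... | yes _ | no _  = let f , f∈ , eqs = multiplicity⇒∈ E h in f , there f∈ , eqs
  ... | no _  | _     = let f , f∈ , eqs = multiplicity⇒∈ E h in f , there f∈ , eqs

  multiplicity-diagonal : ∀ u E → multiplicity E u u ≡ 0
  multiplicity-diagonal u [] = refl
  multiplicity-diagonal u (e ∷ E) with lo e ≟ u | hi e ≟ u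
  ... | yes refl | yes h≡l = ⊥-elim (lo≢hi e (sym h≡l))
  ... | yes _ | no _ = multiplicity-diagonal u E
  ... | no _ | _     = multiplicity-diagonal u E

  ∈⇒multiplicity : ∀ {e E} → e ∈ E → 1 ≤ multiplicity E (lo e) (hi e)
  ∈⇒multiplicity {e} e∈E = ≤-trans
    (≤-reflexive (sym (cong₂ _*_ (δ-refl (lo e)) (δ-refl (hi e)))))
    (∈⇒≤∑ˡ (λ f → δ (lo f) (lo e) * δ (hi f) (hi e)) e∈E)

  handshake : ∀ (f : Fin n → ℕ) E →
              sum (λ v → f v * degree E v) ≡ ∑ˡ (λ (w , e) → w * (f (lo e) + f (hi e))) E
  handshake f E = begin
    sum (λ v → f v * degree E v)
      ≡⟨ sum-cong-≗ (λ v → ∑ˡ-* (f v) (λ (w , e) → w * (δ (lo e) v + δ (hi e) v)) E) ⟨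
    sum (λ v → ∑ˡ (λ (w , e) → f v * (w * (δ (lo e) v + δ (hi e) v))) E)
      ≡⟨ ∑-∑ˡ-comm (λ (w , e) v → f v * (w * (δ (lo e) v + δ (hi e) v))) E ⟩
    ∑ˡ (λ (w , e) → sum (λ v → f v * (w * (δ (lo e) v + δ (hi e) v)))) E
      ≡⟨ ∑ˡ-cong (λ (w , e) → pointwise w (lo e) (hi e)) E ⟩
    ∑ˡ (λ (w , e) → w * (f (lo e) + f (hi e))) E ∎
    where
    open ≡-Reasoning
    lemma : ∀ f w a b → f * (w * (a + b)) ≡ w * (a * f + b * f)
    lemma = solve-∀
    pointwise : ∀ w a b → sum (λ v → f v * (w * (δ a v + δ b v))) ≡ w * (f a + f b)
    pointwise w a b = begin
      sum (λ v → f v * (w * (δ a v + δ b v)))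
        ≡⟨ sum-cong-≗ (λ v → lemma (f v) w (δ a v) (δ b v)) ⟩
      sum (λ v → w * (δ a v * f v + δ b v * f v))
        ≡⟨ *-distribˡ-sum w (λ v → δ a v * f v + δ b v * f v) ⟨
      w * sum (λ v → δ a v * f v + δ b v * f v)
        ≡⟨ cong (w *_) (∑-distrib-+ (λ v → δ a v * f v) (λ v → δ b v * f v)) ⟩
      w * (sum (λ v → δ a v * f v) + sum (λ v → δ b v * f v))
        ≡⟨ cong (w *_) (cong₂ _+_ (∑-δ a f) (∑-δ b f)) ⟩
      w * (f a + f b) ∎

  handshake₁ : ∀ (f : Fin n → ℕ) E → sum (λ v → f v * deg E v) ≡ ∑ˡ (λ e → f (lo e) + f (hi e)) E
  handshake₁ f E = trans (handshake f (ones E))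
    (trans (∑ˡ-map (λ (w , e) → w * (f (lo e) + f (hi e))) (λ e → 1 , e) E)
           (∑ˡ-cong (λ e → *-identityˡ (f (lo e) + f (hi e))) E))

  degree-++ : ∀ (E E′ : List (ℕ × Edge n)) v → degree (E ++ E′) v ≡ degree E v + degree E′ v
  degree-++ E E′ v = ∑ˡ-++ (λ (w , e) → w * (δ (lo e) v + δ (hi e) v)) E E′

  inside-++ : ∀ S (E E′ : List (ℕ × Edge n)) → inside S (E ++ E′) ≡ inside S E + inside S E′
  inside-++ S = ∑ˡ-++ (weight S)

  ∑-deg : ∀ E → sum (deg E) ≡ 2 * length E
  ∑-deg E = begin
    sum (deg E)                              ≡⟨ sum-cong-≗ (λ v → sym (*-identityˡ (deg E v))) ⟩
    sum (λ v → 1 * deg E v)                  ≡⟨ handshake₁ (λ _ → 1) E ⟩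
    ∑ˡ (λ _ → 2) E                           ≡⟨ ∑ˡ-const 2 E ⟩
    length E * 2                             ≡⟨ *-comm (length E) 2 ⟩
    2 * length E ∎
    where open ≡-Reasoning

  disjoint⇒deg≡0 : ∀ e {M : List (Edge n)} {v} → All (Disjoint e) M → v ≡ lo e ⊎ v ≡ hi e → deg M v ≡ 0
  disjoint⇒deg≡0 e [] _ = refl
  disjoint⇒deg≡0 e (((a , b) , _) ∷ ps) v∈@(inj₁ refl)
    rewrite δ-≢ (a ∘ sym) | δ-≢ (b ∘ sym) = disjoint⇒deg≡0 e ps v∈
  disjoint⇒deg≡0 e ((_ , (a , b)) ∷ ps) v∈@(inj₂ refl)
    rewrite δ-≢ (a ∘ sym) | δ-≢ (b ∘ sym) = disjoint⇒deg≡0 e ps v∈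

  disjoint⇒deg≤1 : ∀ {M : List (Edge n)} → AllPairs Disjoint M → ∀ v → deg M v ≤ 1
  disjoint⇒deg≤1 [] v = z≤n
  disjoint⇒deg≤1 {e ∷ M} (p ∷ ps) v with lo e ≟ v | hi e ≟ v
  ... | yes refl | yes h≡l = ⊥-elim (lo≢hi e (sym h≡l))
  ... | yes refl | no _ rewrite disjoint⇒deg≡0 e p (inj₁ refl) = ≤-refl
  ... | no _ | yes refl rewrite disjoint⇒deg≡0 e p (inj₂ refl) = ≤-refl
  ... | no _ | no _ = disjoint⇒deg≤1 ps v

  degree-weigh≤ : ∀ (w : Edge n → ℕ) (f : Fin n → ℕ) E → All (λ e → w e ≤ f (lo e) × w e ≤ f (hi e)) E →
                  ∀ v → degree (weigh w E) v ≤ f v * deg E v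
  degree-weigh≤ w f [] _ v = z≤n
  degree-weigh≤ w f (e ∷ E) ((w≤l , w≤h) ∷ ps) v = begin
    w e * d + degree (weigh w E) v  ≤⟨ +-mono-≤ head (degree-weigh≤ w f E ps v) ⟩
    f v * d + f v * deg E v         ≡⟨ *-distribˡ-+ (f v) d (deg E v) ⟨
    f v * (d + deg E v)             ≡⟨ cong (λ t → f v * (t + deg E v)) (*-identityˡ d) ⟨
    f v * deg (e ∷ E) v ∎
    where
    open ≤-Reasoning
    d = δ (lo e) v + δ (hi e) v
    head : w e * (δ (lo e) v + δ (hi e) v) ≤ f v * (δ (lo e) v + δ (hi e) v)
    head with lo e ≟ v | hi e ≟ v
    ... | yes refl | _    = *-monoˡ-≤ _ w≤l
    ... | no _ | yes refl = *-monoˡ-≤ 1 w≤h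
    ... | no _ | no _     = ≤-reflexive (trans (*-zeroʳ (w e)) (sym (*-zeroʳ (f v))))

  inside-weigh≤ : ∀ (w : Edge n → ℕ) c S E → All (λ e → w e ≤ c) E → inside S (weigh w E) ≤ c * inside S (ones E)
  inside-weigh≤ w c S [] _ = z≤n
  inside-weigh≤ w c S (e ∷ E) (w≤c ∷ ps) = begin
    w e * p + inside S (weigh w E)     ≤⟨ +-mono-≤ (*-monoˡ-≤ p w≤c) (inside-weigh≤ w c S E ps) ⟩
    c * p + c * inside S (ones E)      ≡⟨ *-distribˡ-+ c p (inside S (ones E)) ⟨
    c * (p + inside S (ones E))        ≡⟨ cong (λ t → c * (t + inside S (ones E))) (*-identityˡ p) ⟨
    c * inside S (ones (e ∷ E)) ∎
    where
    open ≤-Reasoning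
    p = ⟦ S (lo e) ⟧ * ⟦ S (hi e) ⟧

  2*inside≤ : ∀ S E c → (∀ v → degree E v ≤ c) → 2 * inside S E ≤ c * card S
  2*inside≤ S E c deg≤c = begin
    2 * inside S E                                           ≡⟨ ∑ˡ-* 2 (weight S) E ⟨
    ∑ˡ (λ we → 2 * weight S we) E
      ≤⟨ ∑ˡ-mono (All.universal (λ (w , e) → pointwise w (S (lo e)) (S (hi e))) E) ⟩
    ∑ˡ (λ (w , e) → w * (⟦ S (lo e) ⟧ + ⟦ S (hi e) ⟧)) E     ≡⟨ handshake (⟦_⟧ ∘ S) E ⟨
    sum (λ v → ⟦ S v ⟧ * degree E v)                         ≤⟨ sum-mono-≤ (λ v → *-monoʳ-≤ ⟦ S v ⟧ (deg≤c v)) ⟩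
    sum (λ v → ⟦ S v ⟧ * c)                                  ≡⟨ *-distribʳ-sum c (⟦_⟧ ∘ S) ⟨
    card S * c                                               ≡⟨ *-comm (card S) c ⟩
    c * card S ∎
    where
    open ≤-Reasoning
    pointwise : ∀ w a b → 2 * (w * (⟦ a ⟧ * ⟦ b ⟧)) ≤ w * (⟦ a ⟧ + ⟦ b ⟧)
    pointwise w false b     = ≤-trans (≤-reflexive (cong (2 *_) (*-zeroʳ w))) z≤n
    pointwise w true  false = ≤-trans (≤-reflexive (cong (2 *_) (*-zeroʳ w))) z≤n
    pointwise w true  true  = ≤-reflexive (trans (cong (2 *_) (*-identityʳ w)) (*-comm 2 w))

  matching-inside : ∀ S E → (∀ v → deg E v ≤ 1) → inside S (ones E) ≤ ⌊ card S /2⌋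
  matching-inside S E deg≤1 = begin
    inside S (ones E)                          ≡⟨ n≡⌊n+n/2⌋ _ ⟩
    ⌊ inside S (ones E) + inside S (ones E) /2⌋ ≡⟨ cong (λ t → ⌊ inside S (ones E) + t /2⌋) (+-identityʳ _) ⟨
    ⌊ 2 * inside S (ones E) /2⌋                ≤⟨ ⌊n/2⌋-mono (2*inside≤ S (ones E) 1 deg≤1) ⟩
    ⌊ 1 * card S /2⌋                           ≡⟨ cong ⌊_/2⌋ (*-identityˡ (card S)) ⟩
    ⌊ card S /2⌋ ∎
    where open ≤-Reasoning

  -- Among the ordered pairs of vertices of `S`, each off the diagonal carries at most one edge and
  -- the diagonal carries none. The diagonal accounts for the summand `card S`.
  simple-inside : ∀ S E → (∀ u v → multiplicity E u v ≤ 1) → inside S (ones E) + card S ≤ card S * card S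
  simple-inside S E simple = begin
    inside S (ones E) + card S
      ≡⟨ cong₂ _+_ inside≡ card≡ ⟩
    sum row + sum diag
      ≡⟨ ∑-distrib-+ row diag ⟨
    sum (λ u → row u + diag u)
      ≡⟨ sum-cong-≗ (λ u → ∑-distrib-+ (λ v → χ u v * multiplicity E u v) (λ v → χ u v * δ u v)) ⟨
    sum (λ u → sum (λ v → χ u v * multiplicity E u v + χ u v * δ u v))
      ≤⟨ sum-mono-≤ (λ u → sum-mono-≤ (λ v → pointwise u v)) ⟩
    sum (λ u → sum (λ v → χ u v))
      ≡⟨ sum-cong-≗ (λ u → *-distribˡ-sum ⟦ S u ⟧ (⟦_⟧ ∘ S)) ⟨
    sum (λ u → ⟦ S u ⟧ * card S)
      ≡⟨ *-distribʳ-sum (card S) (⟦_⟧ ∘ S) ⟨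
    card S * card S ∎
    where
    open ≤-Reasoning
    χ : Fin n → Fin n → ℕ
    χ u v = ⟦ S u ⟧ * ⟦ S v ⟧
    row diag : Fin n → ℕ
    row u = sum (λ v → χ u v * multiplicity E u v)
    diag u = sum (λ v → χ u v * δ u v)
    pointwise : ∀ u v → χ u v * multiplicity E u v + χ u v * δ u v ≤ χ u v
    pointwise u v rewrite sym (*-distribˡ-+ (χ u v) (multiplicity E u v) (δ u v))
      = ≤-trans (*-monoʳ-≤ (χ u v) bound) (≤-reflexive (*-identityʳ (χ u v)))
      where
      bound : multiplicity E u v + δ u v ≤ 1
      bound with u ≟ v
      ... | yes refl = ≤-reflexive (cong (_+ 1) (multiplicity-diagonal u E))
      ... | no _     = ≤-trans (≤-reflexive (+-identityʳ _)) (simple u v)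
    square : ∀ a → ⟦ a ⟧ * ⟦ a ⟧ ≡ ⟦ a ⟧
    square true  = refl
    square false = refl
    card≡ : card S ≡ sum (λ u → sum (λ v → χ u v * δ u v))
    card≡ = sum-cong-≗ λ u → trans (sym (square (S u))) (trans (sym (∑-δ u (χ u)))
      (sum-cong-≗ λ v → *-comm (δ u v) (χ u v)))
    lemma : ∀ s t a b → s * t * (a * b) ≡ a * (s * (b * t))
    lemma = solve-∀
    term : ∀ a b → sum (λ u → sum (λ v → χ u v * (δ a u * δ b v))) ≡ 1 * χ a b
    term a b = trans (trans (sum-cong-≗ λ u →
      trans (trans (trans (sum-cong-≗ λ v → lemma ⟦ S u ⟧ ⟦ S v ⟧ (δ a u) (δ b v))
                          (sym (*-distribˡ-sum (δ a u) (λ v → ⟦ S u ⟧ * (δ b v * ⟦ S v ⟧)))))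
                   (cong (δ a u *_) (sym (*-distribˡ-sum ⟦ S u ⟧ (λ v → δ b v * ⟦ S v ⟧)))))
            (cong (λ t → δ a u * (⟦ S u ⟧ * t)) (∑-δ b (⟦_⟧ ∘ S))))
      (∑-δ a (λ u → ⟦ S u ⟧ * ⟦ S b ⟧))) (sym (*-identityˡ _))
    entry : Edge n → Fin n → Fin n → ℕ
    entry e u v = χ u v * (δ (lo e) u * δ (hi e) v)
    inside≡ : inside S (ones E) ≡ sum row
    inside≡ = begin-equality
      inside S (ones E)                           ≡⟨ ∑ˡ-map (weight S) (λ e → 1 , e) E ⟩
      ∑ˡ (λ e → weight S (1 , e)) E               ≡⟨ ∑ˡ-cong (λ e → term (lo e) (hi e)) E ⟨
      ∑ˡ (λ e → sum (λ u → sum (entry e u))) E    ≡⟨ ∑-∑ˡ-comm (λ e u → sum (entry e u)) E ⟨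
      sum (λ u → ∑ˡ (λ e → sum (entry e u)) E)    ≡⟨ sum-cong-≗ (λ u → ∑-∑ˡ-comm (λ e → entry e u) E) ⟨
      sum (λ u → sum (λ v → ∑ˡ (λ e → entry e u v) E))
        ≡⟨ sum-cong-≗ (λ u → sum-cong-≗ (λ v → ∑ˡ-* (χ u v) (λ e → δ (lo e) u * δ (hi e) v) E)) ⟩
      sum row ∎

-- The fractional matching supported on `M` and `F`.

atMost : ℕ → ℕ → ℕ
atMost x y = ⟦ x ≤ᵇ y ⟧

atMost-≤ : ∀ {x y} → x ≤ y → atMost x y ≡ 1
atMost-≤ {x} {y} x≤y with x ≤ᵇ y | ≤⇒≤ᵇ x≤y
... | true | _ = refl

-- A pointwise Markov inequality: it lets degrees pay for the number of saturated vertices.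
*-atMost : ∀ c x y → c * x * atMost x y ≤ c * y
*-atMost c x y with x ≤ᵇ y in eq
... | true  = ≤-trans (≤-reflexive (*-identityʳ (c * x))) (*-monoʳ-≤ c (≤ᵇ⇒≤ x y (subst Bool.T (sym eq) _)))
... | false = ≤-trans (≤-reflexive (*-zeroʳ (c * x))) z≤n

module _ (unmatchedCap matchedCap : ℕ) where

  -- The argument is the degree of the vertex in M.
  cap : ℕ → ℕ
  cap zero    = unmatchedCap
  cap (suc _) = matchedCap

module _ {n} {G H : Graph n} {M F : List (Edge n)} (a k : ℕ)
         (M⊆H : All (_∈E H) M) (M-deg : ∀ v → deg M v ≤ 1)
         (M-maximal : ∀ e → e ∈E G → 1 ≤ deg M (lo e) + deg M (hi e))
         (F⊆H : All (_∈E H) F) (F-deg : ∀ v → deg F v ≤ cap (a + k) k (deg M v))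
         (F-mixed : All (λ e → deg M (lo e) + deg M (hi e) ≡ 1) F)
         (F-simple : ∀ u v → multiplicity F u v ≤ 1)
         (F-maximal : ∀ e → e ∈E G → deg M (lo e) + deg M (hi e) ≡ 1 →
                      1 ≤ multiplicity F (lo e) (hi e)
                      ⊎ cap (a + k) k (deg M (lo e)) ≤ deg F (lo e) ⊎ cap (a + k) k (deg M (hi e)) ≤ deg F (hi e))
         where

  private
    s = a + k

  module Fractional (M* : List (Edge n)) (M*-matching : IsMatching G M*) where

    capacity slack : Fin n → ℕ
    capacity v = cap s k (deg M v)
    slack v = capacity v ∸ deg F v

    inF? : ∀ e → Dec (1 ≤ multiplicity F (lo e) (hi e))
    inF? e = 1 ≤? multiplicity F (lo e) (hi e)

    D : List (Edge n)
    D = filter inF? M*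

    -- `D` is a matching, so a vertex receives at most one raise. The smaller slack therefore keeps
    -- both ends within capacity and fills the tighter one. In `X` such an edge is listed twice,
    -- with weight one and with its raise.
    extra : Edge n → ℕ
    extra e = slack (lo e) ⊓ slack (hi e)

    X E : List (ℕ × Edge n)
    X = ones F ++ weigh extra D
    E = weigh (λ _ → a) M ++ X

    D∈F : ∀ {P : Fin n → Fin n → Set} → All (λ e → P (lo e) (hi e)) F → All (λ e → P (lo e) (hi e)) D
    D∈F {P} allF = All.tabulate λ {e} e∈D →
      let f , f∈F , l , h = multiplicity⇒∈ F (proj₂ (∈-filter⁻ inF? {xs = M*} e∈D))
      in subst₂ P l h (All.lookup allF f∈F)

    D-deg : ∀ v → deg D v ≤ 1
    D-deg = disjoint⇒deg≤1 (AllPairs.filter⁺ inF? (proj₂ M*-matching))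

    E⊆H : All (λ (_ , e) → e ∈E H) E
    E⊆H = All.++⁺ (All.map⁺ M⊆H) (All.++⁺ (All.map⁺ F⊆H) (All.map⁺ (D∈F {Graph.Adj H} F⊆H)))

    X-mixed : All (λ (_ , e) → deg M (lo e) + deg M (hi e) ≡ 1) X
    X-mixed = All.++⁺ (All.map⁺ F-mixed) (All.map⁺ (D∈F {λ u v → deg M u + deg M v ≡ 1} F-mixed))

    degree-X : ∀ v → degree X v ≤ capacity v
    degree-X v = begin
      degree X v                             ≡⟨ degree-++ (ones F) (weigh extra D) v ⟩
      deg F v + degree (weigh extra D) v     ≤⟨ +-monoʳ-≤ (deg F v) (degree-weigh≤ extra slack D
                                                  (All.universal (λ e → m⊓n≤m _ _ , m⊓n≤n (slack (lo e)) _) D) v) ⟩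
      deg F v + slack v * deg D v            ≤⟨ +-monoʳ-≤ (deg F v) (*-monoʳ-≤ (slack v) (D-deg v)) ⟩
      deg F v + slack v * 1                  ≡⟨ cong (deg F v +_) (*-identityʳ (slack v)) ⟩
      deg F v + (capacity v ∸ deg F v)       ≡⟨ m+[n∸m]≡n (F-deg v) ⟩
      capacity v ∎
      where open ≤-Reasoning

    -- The two capacities are made for this: a matched vertex takes `a` from `M` and up to `k` from
    -- `X`, an unmatched one takes up to `s` from `X` alone.
    degree-E : ∀ v → degree E v ≤ s
    degree-E v = begin
      degree E v                               ≡⟨ degree-++ (weigh (λ _ → a) M) X v ⟩
      degree (weigh (λ _ → a) M) v + degree X v  ≤⟨ +-mono-≤ (degree-weigh≤ (λ _ → a) (λ _ → a) M
                                                     (All.universal (λ _ → ≤-refl , ≤-refl) M) v) (degree-X v) ⟩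
      a * deg M v + cap s k (deg M v)          ≤⟨ total (deg M v) (M-deg v) ⟩
      s ∎
      where
      open ≤-Reasoning
      total : ∀ d → d ≤ 1 → a * d + cap s k d ≤ s
      total zero _ = ≤-reflexive (cong (_+ s) (*-zeroʳ a))
      total (suc zero) _ = ≤-reflexive (cong (_+ k) (*-identityʳ a))
      total (suc (suc _)) (s≤s ())

    extra≤k : All (λ e → extra e ≤ k) D
    extra≤k = D∈F {λ u v → slack u ⊓ slack v ≤ k} (All.map (λ {e} → bound e) F-mixed)
      where
      sum≡1 : ∀ d {d′} → d + d′ ≡ 1 → d ≡ 1 ⊎ d′ ≡ 1
      sum≡1 zero       eq = inj₂ eq
      sum≡1 (suc zero) _  = inj₁ refl
      slack≤k : ∀ v → deg M v ≡ 1 → slack v ≤ k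
      slack≤k v eq = ≤-trans (m∸n≤m (capacity v) (deg F v)) (≤-reflexive (cong (cap s k) eq))
      bound : ∀ e → deg M (lo e) + deg M (hi e) ≡ 1 → extra e ≤ k
      bound e mixed with sum≡1 (deg M (lo e)) mixed
      ... | inj₁ eq = ≤-trans (m⊓n≤m (slack (lo e)) (slack (hi e))) (slack≤k (lo e) eq)
      ... | inj₂ eq = ≤-trans (m⊓n≤n (slack (lo e)) (slack (hi e))) (slack≤k (hi e) eq)

    -- `M` and `D` are matchings, so each has at most `⌊ card S /2⌋` edges in `S`, of weight `a` and
    -- at most `k`. As `a + k` is `s`, these two fit the odd-set bound exactly, and only the unit
    -- weights of `F` can violate it.
    inside-E : ∀ S → inside S E ≤ s * ⌊ card S /2⌋ + inside S (ones F)
    inside-E S = begin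
      inside S E
        ≡⟨ inside-++ S (weigh (λ _ → a) M) X ⟩
      inside S (weigh (λ _ → a) M) + inside S X
        ≡⟨ cong (inside S (weigh (λ _ → a) M) +_) (inside-++ S (ones F) (weigh extra D)) ⟩
      inside S (weigh (λ _ → a) M) + (inside S (ones F) + inside S (weigh extra D))
        ≤⟨ +-mono-≤ (≤-trans (inside-weigh≤ (λ _ → a) a S M (All.universal (λ _ → ≤-refl) M))
                             (*-monoʳ-≤ a (matching-inside S M M-deg)))
                    (+-monoʳ-≤ (inside S (ones F)) (≤-trans (inside-weigh≤ extra k S D extra≤k)
                             (*-monoʳ-≤ k (matching-inside S D D-deg)))) ⟩
      a * j + (inside S (ones F) + k * j)
        ≡⟨ lemma a j (inside S (ones F)) k ⟩
      s * j + inside S (ones F) ∎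
      where
      open ≤-Reasoning
      j = ⌊ card S /2⌋
      lemma : ∀ a j f k → a * j + (f + k * j) ≡ (a + k) * j + f
      lemma = solve-∀

    -- Let j be `⌊ card S /2⌋`. If L ≤ 2j, the degree bound s (2j + 1) / 2 exceeds s j by s / 2,
    -- which is at most s j / L. Otherwise 2j + 1 ≤ L, so the simple graph `F` has at most (2j + 1)
    -- 2j ≤ 2 L j edges in `S`, and L times this is at most s j by the choice of s.
    odd-sets : ∀ L → 2 * (L * L) ≤ s → ∀ S → L * inside S E ≤ suc L * s * ⌊ card S /2⌋
    odd-sets L 2L²≤s S with L ≤? 2 * ⌊ card S /2⌋
    ... | yes large = *-cancelˡ-≤ 2 (begin
      2 * (L * inside S E)            ≡⟨ lemma₁ L (inside S E) ⟩
      L * (2 * inside S E)            ≤⟨ *-monoʳ-≤ L (2*inside≤ S E s degree-E) ⟩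
      L * (s * card S)                ≤⟨ *-monoʳ-≤ L (*-monoʳ-≤ s c≤) ⟩
      L * (s * suc (2 * j))           ≡⟨ lemma₂ L s j ⟩
      2 * (L * s * j) + s * L         ≤⟨ +-monoʳ-≤ (2 * (L * s * j)) (*-monoʳ-≤ s large) ⟩
      2 * (L * s * j) + s * (2 * j)   ≡⟨ lemma₃ L s j ⟩
      2 * (suc L * s * j) ∎)
      where
      open ≤-Reasoning
      j = ⌊ card S /2⌋
      c≤ : card S ≤ suc (2 * j)
      c≤ = card≤ (card S)
        where
        card≤ : ∀ c → c ≤ suc (2 * ⌊ c /2⌋)
        card≤ zero = z≤n
        card≤ (suc zero) = s≤s z≤n
        card≤ (suc (suc c)) rewrite +-suc ⌊ c /2⌋ (⌊ c /2⌋ + 0) = s≤s (s≤s (card≤ c))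
      lemma₁ : ∀ L x → 2 * (L * x) ≡ L * (2 * x)
      lemma₁ = solve-∀
      lemma₂ : ∀ L s j → L * (s * suc (2 * j)) ≡ 2 * (L * s * j) + s * L
      lemma₂ = solve-∀
      lemma₃ : ∀ L s j → 2 * (L * s * j) + s * (2 * j) ≡ 2 * (suc L * s * j)
      lemma₃ = solve-∀
    ... | no small = begin
      L * inside S E                          ≤⟨ *-monoʳ-≤ L (inside-E S) ⟩
      L * (s * j + inside S (ones F))         ≤⟨ *-monoʳ-≤ L (+-monoʳ-≤ (s * j) F≤) ⟩
      L * (s * j + suc (2 * j) * (2 * j))     ≤⟨ *-monoʳ-≤ L (+-monoʳ-≤ (s * j) (*-monoˡ-≤ (2 * j) (≰⇒> small))) ⟩
      L * (s * j + L * (2 * j))               ≡⟨ lemma₁ L s j ⟩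
      L * s * j + 2 * (L * L) * j             ≤⟨ +-monoʳ-≤ (L * s * j) (*-monoˡ-≤ j 2L²≤s) ⟩
      L * s * j + s * j                       ≡⟨ lemma₂ L s j ⟩
      suc L * s * j ∎
      where
      open ≤-Reasoning
      j = ⌊ card S /2⌋
      square≤ : ∀ f c → f + c ≤ c * c → f ≤ suc (2 * ⌊ c /2⌋) * (2 * ⌊ c /2⌋)
      square≤ f zero h = ≤-trans (m≤m+n f 0) h
      square≤ f (suc zero) h = ≤-trans (+-cancelʳ-≤ 1 f 0 h) z≤n
      square≤ f (suc (suc c)) h = ≤-trans
        (+-cancelʳ-≤ (suc (suc c)) f (suc c * suc (suc c)) (≤-trans h (≤-reflexive (+-comm (suc (suc c)) _))))
        (≤-trans (≤-reflexive (*-comm (suc c) (suc (suc c)))) (*-mono-≤ (halves c) (s≤s⁻¹ (halves c))))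
        where
        halves : ∀ c → suc (suc c) ≤ suc (2 * suc ⌊ c /2⌋)
        halves zero = s≤s (s≤s z≤n)
        halves (suc zero) = s≤s (s≤s (s≤s z≤n))
        halves (suc (suc c)) rewrite +-suc (suc ⌊ c /2⌋) (suc ⌊ c /2⌋ + 0) = s≤s (s≤s (halves c))
      F≤ : inside S (ones F) ≤ suc (2 * j) * (2 * j)
      F≤ = square≤ _ (card S) (simple-inside S F F-simple)
      lemma₁ : ∀ L s j → L * (s * j + L * (2 * j)) ≡ L * s * j + 2 * (L * L) * j
      lemma₁ = solve-∀
      lemma₂ : ∀ L s j → L * s * j + s * j ≡ suc L * s * j
      lemma₂ = solve-∀

    saturated potential : Fin n → ℕ
    saturated v = atMost (capacity v) (degree X v)
    potential v = deg M v + saturated v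

    saturated≡1 : ∀ {v} → capacity v ≤ degree X v → saturated v ≡ 1
    saturated≡1 = atMost-≤

    degF≤degX : ∀ v → deg F v ≤ degree X v
    degF≤degX v = ≤-trans (m≤m+n (deg F v) (degree (weigh extra D) v))
      (≤-reflexive (sym (degree-++ (ones F) (weigh extra D) v)))

    extra-saturates : ∀ {e v} → e ∈ D → lo e ≡ v ⊎ hi e ≡ v → slack v ≤ extra e → capacity v ≤ degree X v
    extra-saturates {e} {v} e∈D v∈e slack≤ = begin
      capacity v                          ≤⟨ m≤n+m∸n (capacity v) (deg F v) ⟩
      deg F v + slack v                   ≤⟨ +-monoʳ-≤ (deg F v) slack≤degree ⟩
      deg F v + degree (weigh extra D) v  ≡⟨ degree-++ (ones F) (weigh extra D) v ⟨
      degree X v ∎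
      where
      open ≤-Reasoning
      incidence : Edge n → ℕ
      incidence f = δ (lo f) v + δ (hi f) v
      touches : lo e ≡ v ⊎ hi e ≡ v → 1 ≤ δ (lo e) v + δ (hi e) v
      touches (inj₁ refl) rewrite δ-refl (lo e) = s≤s z≤n
      touches (inj₂ refl) rewrite δ-refl (hi e) = m≤n+m 1 _
      slack≤degree : slack v ≤ degree (weigh extra D) v
      slack≤degree = begin
        slack v                   ≤⟨ slack≤ ⟩
        extra e                   ≡⟨ *-identityʳ (extra e) ⟨
        extra e * 1               ≤⟨ *-monoʳ-≤ (extra e) (touches v∈e) ⟩
        extra e * incidence e     ≤⟨ ∈⇒≤∑ˡ (λ (w , f) → w * incidence f) (∈-map⁺ (λ f → extra f , f) e∈D) ⟩
        degree (weigh extra D) v ∎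

    -- Either `F` rejected the edge because an end was full, or `F` holds it; then it belongs to
    -- `D`, and its raise fills the end with the smaller slack.
    saturated-end : ∀ {e} → e ∈ M* → deg M (lo e) + deg M (hi e) ≡ 1 →
                    1 ≤ saturated (lo e) + saturated (hi e)
    saturated-end {e} e∈M* mixed with F-maximal e (All.lookup (proj₁ M*-matching) e∈M*) mixed
    ... | inj₂ (inj₁ full) rewrite saturated≡1 (≤-trans full (degF≤degX (lo e))) = s≤s z≤n
    ... | inj₂ (inj₂ full) rewrite saturated≡1 (≤-trans full (degF≤degX (hi e))) = m≤n+m 1 _
    ... | inj₁ e∈F with ∈-filter⁺ inF? e∈M* e∈F | ≤-total (slack (lo e)) (slack (hi e))
    ...   | e∈D | inj₁ l≤h rewrite saturated≡1 (extra-saturates e∈D (inj₁ refl) (⊓-glb ≤-refl l≤h)) = s≤s z≤n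
    ...   | e∈D | inj₂ h≤l rewrite saturated≡1 (extra-saturates e∈D (inj₂ refl) (⊓-glb h≤l ≤-refl)) = m≤n+m 1 _

    -- Two matched ends give both units. Otherwise exactly one end is matched, by maximality of `M`,
    -- and `saturated-end` supplies the second unit.
    potential-edge : ∀ {e} → e ∈ M* → 2 ≤ potential (lo e) + potential (hi e)
    potential-edge {e} e∈M* = ≤-trans (bound (deg M (lo e) + deg M (hi e)) _
        (M-maximal e (All.lookup (proj₁ M*-matching) e∈M*)) (saturated-end e∈M*))
      (≤-reflexive (lemma (deg M (lo e)) (deg M (hi e)) (saturated (lo e)) (saturated (hi e))))
      where
      lemma : ∀ a b c d → a + b + (c + d) ≡ a + c + (b + d)
      lemma = solve-∀
      bound : ∀ x y → 1 ≤ x → (x ≡ 1 → 1 ≤ y) → 2 ≤ x + y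
      bound (suc zero) y _ h = s≤s (h refl)
      bound (suc (suc x)) y _ _ = s≤s (s≤s z≤n)

    2|M*|≤potential : 2 * length M* ≤ sum potential
    2|M*|≤potential = begin
      2 * length M*                                       ≡⟨ *-comm 2 (length M*) ⟩
      length M* * 2                                       ≡⟨ ∑ˡ-const 2 M* ⟨
      ∑ˡ (λ _ → 2) M*                                     ≤⟨ ∑ˡ-mono (All.tabulate potential-edge) ⟩
      ∑ˡ (λ e → potential (lo e) + potential (hi e)) M*   ≡⟨ handshake₁ potential M* ⟨
      sum (λ v → potential v * deg M* v)                  ≤⟨ sum-mono-≤ pointwise ⟩
      sum potential ∎
      where
      open ≤-Reasoning
      pointwise : ∀ v → potential v * deg M* v ≤ potential v
      pointwise v = ≤-trans (*-monoʳ-≤ (potential v) (disjoint⇒deg≤1 (proj₂ M*-matching) v))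
                            (≤-reflexive (*-identityʳ (potential v)))

    total : List (ℕ × Edge n) → ℕ
    total = ∑ˡ proj₁

    -- The co-capacity pairs with the capacity to the product s k, and adds up to s + k along an edge of X.
    saturation≤ : s * k * sum saturated ≤ total X * (s + k)
    saturation≤ = begin
      s * k * sum saturated                                  ≡⟨ *-distribˡ-sum (s * k) saturated ⟩
      sum (λ v → s * k * saturated v)                        ≤⟨ sum-mono-≤ pointwise ⟩
      sum (λ v → cocap v * degree X v)                       ≡⟨ handshake cocap X ⟩
      ∑ˡ (λ (w , e) → w * (cocap (lo e) + cocap (hi e))) X   ≤⟨ ∑ˡ-mono (All.map (λ {we} → edge-sum {we}) X-mixed) ⟩
      ∑ˡ (λ (w , e) → (s + k) * w) X                         ≡⟨ ∑ˡ-* (s + k) proj₁ X ⟩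
      (s + k) * total X                                      ≡⟨ *-comm (s + k) (total X) ⟩
      total X * (s + k) ∎
      where
      open ≤-Reasoning
      cocap : Fin n → ℕ
      cocap v = cap k s (deg M v)
      product : ∀ d → s * k ≡ cap k s d * cap s k d
      product zero    = *-comm s k
      product (suc _) = refl
      pointwise : ∀ v → s * k * saturated v ≤ cocap v * degree X v
      pointwise v = ≤-trans (≤-reflexive (cong (_* saturated v) (product (deg M v))))
                            (*-atMost (cocap v) (capacity v) (degree X v))
      cocap-sum : ∀ d d′ → d + d′ ≡ 1 → cap k s d + cap k s d′ ≡ s + k
      cocap-sum zero (suc zero) _ = +-comm k s
      cocap-sum (suc zero) zero _ = refl
      edge-sum : ∀ {we : ℕ × Edge n} → let w , e = we in deg M (lo e) + deg M (hi e) ≡ 1 →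
                 w * (cocap (lo e) + cocap (hi e)) ≤ (s + k) * w
      edge-sum {w , e} mixed = ≤-reflexive
        (trans (cong (w *_) (cocap-sum (deg M (lo e)) (deg M (hi e)) mixed)) (*-comm w (s + k)))

    total-E : total E ≡ length M * a + total X
    total-E = trans (∑ˡ-++ proj₁ (weigh (λ _ → a) M) X)
      (cong (_+ total X) (trans (∑ˡ-map proj₁ (λ e → a , e) M) (∑ˡ-const a M)))

    -- Both parts of the potential are bought at the same price: a unit of weight pays for `s + k`.
    -- The matched ends of an edge of `M` cost `2 * (s * k)` and are paid by its weight `a`, which
    -- is what `balance` states; saturated vertices are paid by `X`.
    value : 2 * (s * k) ≤ a * (s + k) → 2 * (s * k) * length M* ≤ total E * (s + k)
    value balance = begin
      2 * (s * k) * length M*                          ≡⟨ lemma₁ (s * k) (length M*) ⟩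
      s * k * (2 * length M*)                          ≤⟨ *-monoʳ-≤ (s * k) 2|M*|≤potential ⟩
      s * k * sum potential                            ≡⟨ cong (s * k *_) (∑-distrib-+ (deg M) saturated) ⟩
      s * k * (sum (deg M) + sum saturated)            ≡⟨ *-distribˡ-+ (s * k) (sum (deg M)) _ ⟩
      s * k * sum (deg M) + s * k * sum saturated      ≡⟨ cong (λ d → s * k * d + s * k * sum saturated) (∑-deg M) ⟩
      s * k * (2 * length M) + s * k * sum saturated   ≡⟨ cong (_+ s * k * sum saturated) (lemma₁ (s * k) (length M)) ⟨
      2 * (s * k) * length M + s * k * sum saturated   ≤⟨ +-mono-≤ (*-monoˡ-≤ (length M) balance) saturation≤ ⟩
      a * (s + k) * length M + total X * (s + k)       ≡⟨ lemma₂ a (s + k) (length M) (total X) ⟩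
      (length M * a + total X) * (s + k)               ≡⟨ cong (_* (s + k)) total-E ⟨
      total E * (s + k) ∎
      where
      open ≤-Reasoning
      lemma₁ : ∀ x m → 2 * x * m ≡ x * (2 * m)
      lemma₁ = solve-∀
      lemma₂ : ∀ a r m x → a * r * m + x * r ≡ (m * a + x) * r
      lemma₂ = solve-∀

  approximation : ∀ L → .{{_ : NonZero s}} → 2 * (L * L) ≤ s → 2 * (s * k) ≤ a * (s + k) →
                  2 * (L * k) * μ G ≤ suc L * (s + k) * μ H
  approximation L 2L²≤s balance with μ-attained G
  ... | M* , matching , len = *-cancelˡ-≤ s (begin
    s * (2 * (L * k) * μ G)            ≡⟨ cong (λ t → s * (2 * (L * k) * t)) len ⟨
    s * (2 * (L * k) * length M*)      ≡⟨ lemma₁ s L k (length M*) ⟩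
    L * (2 * (s * k) * length M*)      ≤⟨ *-monoʳ-≤ L (value balance) ⟩
    L * (total E * (s + k))            ≡⟨ *-assoc L (total E) (s + k) ⟨
    L * total E * (s + k)              ≤⟨ *-monoˡ-≤ (s + k) (fractional≤μ H E E⊆H L (suc L * s) (odd-sets L 2L²≤s)
                                            (λ v → *-mono-≤ (n≤1+n L) (degree-E v))) ⟩
    suc L * s * μ H * (s + k)          ≡⟨ lemma₂ (suc L) s (μ H) (s + k) ⟩
    s * (suc L * (s + k) * μ H) ∎)
    where
    open ≤-Reasoning
    open Fractional M* matching
    lemma₁ : ∀ s L k m → s * (2 * (L * k) * m) ≡ L * (2 * (s * k) * m)
    lemma₁ = solve-∀
    lemma₂ : ∀ l s m r → l * s * m * r ≡ s * (l * r * m)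
    lemma₂ = solve-∀

-- Folds over the stream, memory contents and the two passes.

module _ {A B : Set} (f : B → A → B) where

  foldl-invariant : ∀ {P : B → Set} {Q : A → Set} → (∀ b {x} → Q x → P b → P (f b x)) →
                    ∀ {b xs} → All Q xs → P b → P (foldl f b xs)
  foldl-invariant step []         Pb = Pb
  foldl-invariant step (Qx ∷ Qxs) Pb = foldl-invariant step Qxs (step _ Qx Pb)

  foldl-reaches : ∀ {R : A → B → Set} → (∀ b x → R x (f b x)) → (∀ b {x} y → R x b → R x (f b y)) →
                  ∀ b {x xs} → x ∈ xs → R x (foldl f b xs)
  foldl-reaches {R} hit stable b {xs = x ∷ xs} (here refl) =
    foldl-invariant {R x} {λ _ → x ≡ x} (λ b {y} _ → stable b y) (All.universal (λ _ → refl) xs) (hit b x)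
  foldl-reaches hit stable b {xs = x ∷ xs} (there x∈) = foldl-reaches hit stable (f b x) x∈

module _ {n : ℕ} where

  State : Set
  State = List (Edge n) × List (Edge n)

  -- The orientation of a stored pair tells the two lists apart.
  encode : State → List (Word n)
  encode (M , F) = map (λ e → lo e , hi e) M ++ map (λ e → hi e , lo e) F

  decodeWord : Word n → State → State
  decodeWord (u , v) (M , F) with u Fin.<? v | v Fin.<? u
  ... | yes u<v | _       = edge u v u<v ∷ M , F
  ... | no _    | yes v<u = M , edge v u v<u ∷ F
  ... | no _    | no _    = M , F

  decode : List (Word n) → State
  decode = foldr decodeWord ([] , [])

  decode∘encode : ∀ st → decode (encode st) ≡ st
  decode∘encode ([] , []) = refl
  decode∘encode ([] , edge u v u<v ∷ F) rewrite decode∘encode ([] , F) with v Fin.<? u | u Fin.<? v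
  ... | yes v<u | _      = Irrelevant.⊥-elim (Fin.<-asym v<u u<v)
  ... | no _    | yes _  = refl
  ... | no _    | no u≮v = Irrelevant.⊥-elim (u≮v u<v)
  decode∘encode (edge u v u<v ∷ M , F) rewrite decode∘encode (M , F) with u Fin.<? v | v Fin.<? u
  ... | yes _   | _ = refl
  ... | no u≮v  | _ = Irrelevant.⊥-elim (u≮v u<v)

  length-encode : ∀ M F → length (encode (M , F)) ≡ length M + length F
  length-encode M F = trans (length-++ (map (λ e → lo e , hi e) M))
    (cong₂ _+_ (length-map (λ e → lo e , hi e) M) (length-map (λ e → hi e , lo e) F))

  module _ {space : ℕ} where

    store : State → Vec≤ (Word n) space
    store st with length (encode st) ≤? space
    ... | yes fits = record { vec = Vec.fromList (encode st) ; bound = fits }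
    -- A default for states that are too large; the invariants of the run exclude them.
    ... | no _     = record { vec = Vec.[] ; bound = z≤n }

    load : Vec≤ (Word n) space → State
    load m = decode (Vec.toList (Vec≤.vec m))

    load∘store : ∀ st → length (encode st) ≤ space → load (store st) ≡ st
    load∘store st fits with length (encode st) ≤? space
    ... | yes _   = trans (cong decode (toList∘fromList (encode st))) (decode∘encode st)
    ... | no ¬fits = ⊥-elim (¬fits fits)

    -- Under the invariant every intermediate state fits, so each load recovers what was stored and
    -- the fold over memories follows the fold over states.
    foldl-store : ∀ (f : State → Edge n → State) {Inv : State → Set} →
                  (∀ {st} → Inv st → length (encode st) ≤ space) → (∀ {st} e → Inv st → Inv (f st e)) →
                  ∀ {st} es → Inv st → foldl (λ m e → store (f (load m) e)) (store st) es ≡ store (foldl f st es)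
    foldl-store f fits step [] _ = refl
    foldl-store f {Inv} fits step {st} (e ∷ es) inv
      rewrite load∘store st (fits inv) = foldl-store f {Inv} fits step es (step e inv)

  choose : List (Edge n) → Edge n → List (Edge n)
  choose M e with deg M (lo e) + deg M (hi e)
  ... | zero  = e ∷ M
  ... | suc _ = M

  Admissible : (s k : ℕ) (M F : List (Edge n)) → Edge n → Set
  Admissible s k M F e =
    deg M (lo e) + deg M (hi e) ≡ 1 × multiplicity F (lo e) (hi e) < 1
    × deg F (lo e) < cap s k (deg M (lo e)) × deg F (hi e) < cap s k (deg M (hi e))

  admissible? : ∀ s k M F e → Dec (Admissible s k M F e)
  admissible? s k M F e =
    (deg M (lo e) + deg M (hi e) ℕ.≟ 1) ×-dec (multiplicity F (lo e) (hi e) <? 1)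
    ×-dec (deg F (lo e) <? cap s k (deg M (lo e))) ×-dec (deg F (hi e) <? cap s k (deg M (hi e)))

  extend : (s k : ℕ) (M F : List (Edge n)) → Edge n → List (Edge n)
  extend s k M F e with admissible? s k M F e
  ... | yes _ = e ∷ F
  ... | no _  = F

  pass₁ : State → Edge n → State
  pass₁ (M , F) e = choose M e , F

  pass₂ : (s k : ℕ) → State → Edge n → State
  pass₂ s k (M , F) e = M , extend s k M F e

  foldl-pass₁ : ∀ M F es → foldl pass₁ (M , F) es ≡ (foldl choose M es , F)
  foldl-pass₁ M F []       = refl
  foldl-pass₁ M F (e ∷ es) = foldl-pass₁ (choose M e) F es

  foldl-pass₂ : ∀ s k M F es → foldl (pass₂ s k) (M , F) es ≡ (M , foldl (extend s k M) F es)
  foldl-pass₂ s k M F []       = refl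
  foldl-pass₂ s k M F (e ∷ es) = foldl-pass₂ s k M (extend s k M F e) es

  span : List (Edge n) → Graph n
  span E = record
    { Adj    = λ u v → 1 ≤ multiplicity E u v + multiplicity E v u
    ; symm   = λ {u} {v} → subst (1 ≤_) (+-comm (multiplicity E u v) (multiplicity E v u))
    ; irrefl = λ { {u} refl h → <⇒≱ h (≤-reflexive
        (cong₂ _+_ (multiplicity-diagonal u E) (multiplicity-diagonal u E))) }
    ; adj?   = λ u v → 1 ≤? multiplicity E u v + multiplicity E v u
    }

  ⊆span : ∀ E → All (_∈E span E) E
  ⊆span E = All.tabulate λ e∈E → ≤-trans (∈⇒multiplicity e∈E) (m≤m+n _ _)

  span⊆ : ∀ {G : Graph n} {E} → All (_∈E G) E → ∀ {u v} → Graph.Adj (span E) u v → Graph.Adj G u v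
  span⊆ {G} {E} E⊆G {u} {v} h with multiplicity E u v in eq
  ... | suc _ with multiplicity⇒∈ E {u} {v} (subst (1 ≤_) (sym eq) (s≤s z≤n))
  ...   | e , e∈E , refl , refl = All.lookup E⊆G e∈E
  span⊆ {G} {E} E⊆G {u} {v} h | zero with multiplicity⇒∈ E {v} {u} h
  ...   | e , e∈E , refl , refl = Graph.symm G (All.lookup E⊆G e∈E)

  deg-∷ : ∀ e (E : List (Edge n)) v → deg (e ∷ E) v ≡ (δ (lo e) v + δ (hi e) v) + deg E v
  deg-∷ e E v = cong (_+ deg E v) (*-identityˡ (δ (lo e) v + δ (hi e) v))

  deg-∷-≤ : ∀ {c : Fin n → ℕ} e (E : List (Edge n)) → deg E (lo e) < c (lo e) → deg E (hi e) < c (hi e) →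
            (∀ v → deg E v ≤ c v) → ∀ v → deg (e ∷ E) v ≤ c v
  deg-∷-≤ e E lo< hi< E≤ v rewrite deg-∷ e E v with lo e ≟ v | hi e ≟ v
  ... | yes refl | yes h≡l  = ⊥-elim (lo≢hi e (sym h≡l))
  ... | yes refl | no _     = lo<
  ... | no _     | yes refl = hi<
  ... | no _     | no _     = E≤ v

  deg-∷-mono : ∀ e (E : List (Edge n)) v → deg E v ≤ deg (e ∷ E) v
  deg-∷-mono e E v = m≤n+m (deg E v) _

  choose-deg : ∀ M e → (∀ v → deg M v ≤ 1) → ∀ v → deg (choose M e) v ≤ 1
  choose-deg M e M≤1 with deg M (lo e) + deg M (hi e) in eq
  ... | suc _ = M≤1
  ... | zero  = deg-∷-≤ {c = λ _ → 1} e M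
    (s≤s (≤-reflexive (m+n≡0⇒m≡0 (deg M (lo e)) eq))) (s≤s (≤-reflexive (m+n≡0⇒n≡0 (deg M (lo e)) eq))) M≤1

  choose-covers : ∀ M e → 1 ≤ deg (choose M e) (lo e) + deg (choose M e) (hi e)
  choose-covers M e with deg M (lo e) + deg M (hi e) in eq
  ... | suc _ = subst (1 ≤_) (sym eq) (s≤s z≤n)
  ... | zero rewrite δ-refl (lo e) = s≤s z≤n

  choose-mono : ∀ M e v → deg M v ≤ deg (choose M e) v
  choose-mono M e v with deg M (lo e) + deg M (hi e)
  ... | suc _ = ≤-refl
  ... | zero  = deg-∷-mono e M v

  choose-⊆ : ∀ {P : Edge n → Set} M {e} → P e → All P M → All P (choose M e)
  choose-⊆ M {e} Pe PM with deg M (lo e) + deg M (hi e)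
  ... | suc _ = PM
  ... | zero  = Pe ∷ PM

  module _ (s k : ℕ) (M : List (Edge n)) where

    record Valid (F : List (Edge n)) : Set where
      field
        bounded : ∀ v → deg F v ≤ cap s k (deg M v)
        mixed   : All (λ e → deg M (lo e) + deg M (hi e) ≡ 1) F
        simple  : ∀ u v → multiplicity F u v ≤ 1

    []-valid : Valid []
    []-valid = record { bounded = λ _ → z≤n ; mixed = [] ; simple = λ _ _ → z≤n }

    extend-valid : ∀ F e → Valid F → Valid (extend s k M F e)
    extend-valid F e valid with admissible? s k M F e
    ... | no _ = valid
    ... | yes (mixed-e , new , lo< , hi<) = record
      { bounded = deg-∷-≤ {c = λ v → cap s k (deg M v)} e F lo< hi< bounded
      ; mixed   = mixed-e ∷ mixed
      ; simple  = simple′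
      }
      where
      open Valid valid
      simple′ : ∀ u v → multiplicity (e ∷ F) u v ≤ 1
      simple′ u v with lo e ≟ u | hi e ≟ v
      ... | yes refl | yes refl = new
      ... | yes _    | no _     = simple u v
      ... | no _     | _        = simple u v

    Handled : Edge n → List (Edge n) → Set
    Handled e F = deg M (lo e) + deg M (hi e) ≡ 1 →
      1 ≤ multiplicity F (lo e) (hi e)
      ⊎ cap s k (deg M (lo e)) ≤ deg F (lo e) ⊎ cap s k (deg M (hi e)) ≤ deg F (hi e)

    extend-handles : ∀ F e → Handled e (extend s k M F e)
    extend-handles F e mixed with admissible? s k M F e
    ... | yes _ = inj₁ (∈⇒multiplicity {E = e ∷ F} (here refl))
    ... | no ¬adm with multiplicity F (lo e) (hi e) <? 1 | deg F (lo e) <? cap s k (deg M (lo e))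
                    | deg F (hi e) <? cap s k (deg M (hi e))
    ...   | no old | _       | _       = inj₁ (≮⇒≥ old)
    ...   | yes _  | no full | _       = inj₂ (inj₁ (≮⇒≥ full))
    ...   | yes _  | yes _   | no full = inj₂ (inj₂ (≮⇒≥ full))
    ...   | yes a  | yes b   | yes c   = ⊥-elim (¬adm (mixed , a , b , c))

    -- Presence in `F` and fullness of an end both persist as `F` grows, so a decision taken when an
    -- edge passes by stays justified at the end of the pass.
    extend-keeps : ∀ F {e} f → Handled e F → Handled e (extend s k M F f)
    extend-keeps F {e} f handled mixed with admissible? s k M F f
    ... | no _ = handled mixed
    ... | yes _ with handled mixed
    ...   | inj₁ present     = inj₁ (≤-trans present (m≤n+m (multiplicity F (lo e) (hi e)) _))
    ...   | inj₂ (inj₁ full) = inj₂ (inj₁ (≤-trans full (deg-∷-mono f F (lo e))))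
    ...   | inj₂ (inj₂ full) = inj₂ (inj₂ (≤-trans full (deg-∷-mono f F (hi e))))

    extend-⊆ : ∀ {P : Edge n → Set} F {e} → P e → All P F → All P (extend s k M F e)
    extend-⊆ F {e} Pe PF with admissible? s k M F e
    ... | yes _ = Pe ∷ PF
    ... | no _  = PF

    -- Each edge is charged to its only matched end, which receives at most `k` charges. The larger
    -- cap at unmatched vertices thus has no effect on the space.
    length-valid : ∀ {F} → (∀ v → deg M v ≤ 1) → Valid F → length F ≤ k * n
    length-valid {F} M≤1 valid = begin
      length F                                        ≡⟨ *-identityʳ (length F) ⟨
      length F * 1                                    ≡⟨ ∑ˡ-const 1 F ⟨
      ∑ˡ (λ _ → 1) F                                  ≤⟨ ∑ˡ-mono (All.map (≤-reflexive ∘ sym) mixed) ⟩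
      ∑ˡ (λ e → deg M (lo e) + deg M (hi e)) F        ≡⟨ handshake₁ (deg M) F ⟨
      sum (λ v → deg M v * deg F v)                   ≤⟨ sum-mono-≤ pointwise ⟩
      sum {n} (λ _ → k)                               ≡⟨ ∑-const n k ⟩
      n * k                                           ≡⟨ *-comm n k ⟩
      k * n ∎
      where
      open ≤-Reasoning
      open Valid valid
      term : ∀ {d} → d ≤ 1 → d * cap s k d ≤ k
      term z≤n       = z≤n
      term (s≤s z≤n) = ≤-reflexive (*-identityˡ k)
      pointwise : ∀ v → deg M v * deg F v ≤ k
      pointwise v = ≤-trans (*-monoʳ-≤ (deg M v) (bounded v)) (term (M≤1 v))

  length-matching : ∀ (M : List (Edge n)) → (∀ v → deg M v ≤ 1) → length M ≤ n
  length-matching M M≤1 = begin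
    length M           ≤⟨ m≤m+n (length M) _ ⟩
    2 * length M       ≡⟨ ∑-deg M ⟨
    sum (deg M)        ≤⟨ sum-mono-≤ M≤1 ⟩
    sum {n} (λ _ → 1)  ≡⟨ ∑-const n 1 ⟩
    n * 1              ≡⟨ *-identityʳ n ⟩
    n ∎
    where open ≤-Reasoning

  opaque
    -- This is the witness of the exhaustive search behind `μ`, opaque for the same reason as `ν`.
    maximumMatching : Graph n → List (Edge n)
    maximumMatching G = proj₁ (μ-attained G)

    maximumMatching-matching : ∀ G → IsMatching G (maximumMatching G)
    maximumMatching-matching G = proj₁ (proj₂ (μ-attained G))

    length-maximumMatching : ∀ G → length (maximumMatching G) ≡ μ G
    length-maximumMatching G = proj₂ (proj₂ (μ-attained G))

  stored : State → Graph n
  stored (M , F) = span (M ++ F)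

-- The space is `n` words for the matching and `k * n` for the edges of the second pass.
algorithm : (s k n : ℕ) → TwoPassAlgorithm n (suc k * n)
algorithm s k n = record
  { initial = store ([] , [])
  ; step₁   = λ m e → store (pass₁ (load m) e)
  ; between = λ m → m
  ; step₂   = λ m e → store (pass₂ s k (load m) e)
  ; output  = λ m → maximumMatching (stored (load m))
  }

-- Correctness of a run.

module Run (s k : ℕ) {n : ℕ} (stream : List (Edge n)) where

  M F : List (Edge n)
  M = foldl choose [] stream
  F = foldl (extend s k M) [] stream

  M-deg : ∀ v → deg M v ≤ 1
  M-deg = foldl-invariant choose {λ M → ∀ v → deg M v ≤ 1} {λ _ → ℕ}
    (λ M {e} _ → choose-deg M e) (All.universal (λ _ → 0) stream) (λ _ → z≤n)

  F-valid : Valid s k M F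
  F-valid = foldl-invariant (extend s k M) {Valid s k M} {λ _ → ℕ}
    (λ F {e} _ → extend-valid s k M F e) (All.universal (λ _ → 0) stream) ([]-valid s k M)

  fits : ∀ {M F} → (∀ v → deg M v ≤ 1) → Valid s k M F → length (encode (M , F)) ≤ suc k * n
  fits {M} {F} M≤1 valid = ≤-trans (≤-reflexive (length-encode M F))
    (+-mono-≤ (length-matching M M≤1) (length-valid s k M M≤1 valid))

  run-algorithm : run (algorithm s k n) stream ≡ maximumMatching (stored (M , F))
  run-algorithm = cong (λ st → maximumMatching (stored st)) (begin
    load (foldl step₂ (foldl step₁ (store ([] , [])) stream) stream)
      ≡⟨ cong (λ m → load (foldl step₂ m stream)) first ⟩
    load (foldl step₂ (store (M , [])) stream)
      ≡⟨ cong load second ⟩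
    load {space = suc k * n} (store (M , F))
      ≡⟨ load∘store (M , F) (fits M-deg F-valid) ⟩
    (M , F) ∎)
    where
    open ≡-Reasoning
    open TwoPassAlgorithm (algorithm s k n) using (step₁; step₂)
    first : foldl step₁ (store ([] , [])) stream ≡ store {space = suc k * n} (M , [])
    first = trans
      (foldl-store pass₁ {λ (M , F) → (∀ v → deg M v ≤ 1) × F ≡ []}
        (λ { {M , _} (M≤1 , refl) → fits M≤1 ([]-valid s k M) })
        (λ { {M , _} e (M≤1 , eq) → choose-deg M e M≤1 , eq })
        stream ((λ _ → z≤n) , refl))
      (cong store (foldl-pass₁ [] [] stream))
    second : foldl step₂ (store (M , [])) stream ≡ store {space = suc k * n} (M , F)
    second = trans
      (foldl-store (pass₂ s k) {λ (M′ , F) → M′ ≡ M × Valid s k M F}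
        (λ { (refl , valid) → fits M-deg valid })
        (λ { {_ , F} e (refl , valid) → refl , extend-valid s k M F e valid })
        stream (refl , []-valid s k M))
      (cong store (foldl-pass₂ s k M [] stream))

  module _ {G : Graph n} (streamOf : IsStreamOf G stream) where

    private
      stream⊆G : All (_∈E G) stream
      stream⊆G = All.tabulate λ {e} → Equivalence.to (proj₂ streamOf e)

      ∈stream : ∀ e → e ∈E G → e ∈ stream
      ∈stream e = Equivalence.from (proj₂ streamOf e)

      M⊆G : All (_∈E G) M
      M⊆G = foldl-invariant choose (λ M e∈G → choose-⊆ M e∈G) stream⊆G []

      F⊆G : All (_∈E G) F
      F⊆G = foldl-invariant (extend s k M) (λ F e∈G → extend-⊆ s k M F e∈G) stream⊆G []

      H : Graph n
      H = span (M ++ F)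

    output-matching : IsMatching G (run (algorithm s k n) stream)
    output-matching = subst (IsMatching G) (sym run-algorithm)
      ( All.map (span⊆ {G = G} (All.++⁺ M⊆G F⊆G)) (proj₁ (maximumMatching-matching H))
      , proj₂ (maximumMatching-matching H))

    output-size : ∀ a L .{{_ : NonZero s}} → s ≡ a + k → 2 * (L * L) ≤ s → 2 * (s * k) ≤ a * (s + k) →
                  2 * (L * k) * μ G ≤ suc L * (s + k) * length (run (algorithm s k n) stream)
    output-size a L refl 2L²≤s balance = subst (λ l → 2 * (L * k) * μ G ≤ suc L * (s + k) * l)
      (sym (trans (cong length run-algorithm) (length-maximumMatching H)))
      (approximation {G = G} {H = H} {M = M} {F = F} a k
        (All.++⁻ˡ M (⊆span (M ++ F))) M-deg
        (λ e e∈G → foldl-reaches choose {λ e M → 1 ≤ deg M (lo e) + deg M (hi e)} choose-covers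
          (λ M {e} f h → ≤-trans h (+-mono-≤ (choose-mono M f (lo e)) (choose-mono M f (hi e)))) [] (∈stream e e∈G))
        (All.++⁻ʳ M (⊆span (M ++ F))) (Valid.bounded F-valid) (Valid.mixed F-valid) (Valid.simple F-valid)
        (λ e e∈G → foldl-reaches (extend s k M) {Handled s k M} (extend-handles s k M)
          (extend-keeps s k M) [] (∈stream e e∈G))
        L 2L²≤s balance)

-- As r = ⌊√2 s⌋, the ratio k / s approximates √2 − 1 from below; a is the weight of an edge of M.
module Parameters (n₀ r : ℕ) (r≡root : r ≡ root n₀) where

  s k a : ℕ
  s = suc n₀
  k = r ∸ s
  a = s ∸ k

  r²≤2s² : r * r ≤ 2 * (s * s)
  r²≤2s² = subst (λ r → r * r ≤ 2 * (s * s)) (sym r≡root) (isqrt-lower (2 * (s * s)))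

  2s²<[1+r]² : 2 * (s * s) < suc r * suc r
  2s²<[1+r]² = subst (λ r → 2 * (s * s) < suc r * suc r) (sym r≡root) (isqrt-upper (2 * (s * s)))

  2s²≤r²+2r : 2 * (s * s) ≤ r * (r + 2)
  2s²≤r²+2r = s≤s⁻¹ (≤-trans 2s²<[1+r]² (≤-reflexive (lemma r)))
    where
    lemma : ∀ r → suc r * suc r ≡ suc (r * (r + 2))
    lemma = solve-∀

  s≤r : s ≤ r
  s≤r = ≮⇒≥ λ r<s → <⇒≱ 2s²<[1+r]² (≤-trans (*-mono-≤ r<s r<s) (m≤m+n (s * s) _))

  r≤2s : r ≤ s + s
  r≤2s = ≮⇒≥ λ 2s<r → <⇒≱ (*-mono-< 2s<r 2s<r)
    (≤-trans r²≤2s² (≤-trans (m≤m+n (2 * (s * s)) (2 * (s * s))) (≤-reflexive (lemma s))))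
    where
    lemma : ∀ s → 2 * (s * s) + 2 * (s * s) ≡ (s + s) * (s + s)
    lemma = solve-∀

  s+k≡r : s + k ≡ r
  s+k≡r = m+[n∸m]≡n s≤r

  s≡a+k : s ≡ a + k
  s≡a+k = sym (m∸n+n≡m (m≤n+o⇒m∸n≤o r s r≤2s))

  -- With s = a + k and r = a + 2k this is r² ≤ 2 s² after cancelling (a + k)² + k² on both sides.
  balance : 2 * (s * k) ≤ a * (s + k)
  balance = subst (λ s → 2 * (s * k) ≤ a * (s + k)) (sym s≡a+k)
    (+-cancelˡ-≤ ((a + k) * (a + k) + k * k) _ _ (begin
      (a + k) * (a + k) + k * k + 2 * ((a + k) * k)  ≡⟨ lemma₁ a k ⟩
      (a + k + k) * (a + k + k)                      ≤⟨ squares ⟩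
      2 * ((a + k) * (a + k))                        ≡⟨ lemma₂ a k ⟩
      (a + k) * (a + k) + k * k + a * (a + k + k) ∎))
    where
    open ≤-Reasoning
    squares : (a + k + k) * (a + k + k) ≤ 2 * ((a + k) * (a + k))
    squares = subst (λ s → (s + k) * (s + k) ≤ 2 * (s * s)) s≡a+k
      (subst (λ r → r * r ≤ 2 * (s * s)) (sym s+k≡r) r²≤2s²)
    lemma₁ : ∀ a k → (a + k) * (a + k) + k * k + 2 * ((a + k) * k) ≡ (a + k + k) * (a + k + k)
    lemma₁ = solve-∀
    lemma₂ : ∀ a k → 2 * ((a + k) * (a + k)) ≡ (a + k) * (a + k) + k * k + a * (a + k + k)
    lemma₂ = solve-∀

  instance
    r≢0 : NonZero r
    r≢0 = >-nonZero (≤-trans (s≤s z≤n) s≤r)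

  -- Divided by s Q m, the conclusion reads 2 - r/s - 1/Q ≤ l/m. The main term is 2k/(s + k) = 2 -
  -- 2s/r ≥ 2 - (r + 2)/s. Two errors remain: `s * l` from the factor (L + 1)/L with L = 2Q, and
  -- `4 * Q * m` from rounding in r. Each is at most `s * m`, and together they make up the 1/Q.
  ratio : ∀ Q m l → 4 * Q ≤ s → l ≤ m → 2 * (2 * Q * k) * m ≤ suc (2 * Q) * (s + k) * l →
          2 * (s * Q) * m ≤ s * Q * l + (r * Q + s) * m
  ratio Q m l 4Q≤s l≤m h = *-cancelˡ-≤ 2 (*-cancelˡ-≤ r (begin
    r * (2 * (2 * (s * Q) * m))
      ≡⟨ cong (λ r → r * (2 * (2 * (s * Q) * m))) s+k≡r ⟨
    (s + k) * (2 * (2 * (s * Q) * m))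
      ≡⟨ lemma₁ s k Q m ⟩
    s * (2 * (2 * Q * k) * m) + 2 * Q * (2 * (s * s)) * m
      ≤⟨ +-mono-≤ (*-monoʳ-≤ s h) (*-monoˡ-≤ m (*-monoʳ-≤ (2 * Q) 2s²≤r²+2r)) ⟩
    s * (suc (2 * Q) * (s + k) * l) + 2 * Q * (r * (r + 2)) * m
      ≡⟨ cong (λ r′ → s * (suc (2 * Q) * r′ * l) + 2 * Q * (r * (r + 2)) * m) s+k≡r ⟩
    s * (suc (2 * Q) * r * l) + 2 * Q * (r * (r + 2)) * m
      ≡⟨ lemma₂ s r Q l m ⟩
    r * (2 * (s * Q * l + r * Q * m) + s * l + 4 * Q * m)
      ≤⟨ *-monoʳ-≤ r (+-mono-≤ (+-monoʳ-≤ (2 * (s * Q * l + r * Q * m)) (*-monoʳ-≤ s l≤m)) (*-monoˡ-≤ m 4Q≤s)) ⟩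
    r * (2 * (s * Q * l + r * Q * m) + s * m + s * m)
      ≡⟨ lemma₃ s r Q l m ⟩
    r * (2 * (s * Q * l + (r * Q + s) * m)) ∎))
    where
    open ≤-Reasoning
    lemma₁ : ∀ s k Q m → (s + k) * (2 * (2 * (s * Q) * m)) ≡ s * (2 * (2 * Q * k) * m) + 2 * Q * (2 * (s * s)) * m
    lemma₁ = solve-∀
    lemma₂ : ∀ s r Q l m → s * (suc (2 * Q) * r * l) + 2 * Q * (r * (r + 2)) * m
                           ≡ r * (2 * (s * Q * l + r * Q * m) + s * l + 4 * Q * m)
    lemma₂ = solve-∀
    lemma₃ : ∀ s r Q l m → r * (2 * (s * Q * l + r * Q * m) + s * m + s * m) ≡ r * (2 * (s * Q * l + (r * Q + s) * m))
    lemma₃ = solve-∀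

-- From integer inequalities to the real bound.

/-≡ : ∀ a k b l → a * suc l ≡ b * suc k → ℤ.+ a ℚ./ suc k ≡ ℤ.+ b ℚ./ suc l
/-≡ a k b l eq = ℚ.≤-antisym (/-mono a k b l (≤-reflexive eq)) (/-mono b l a k (≤-reflexive (sym eq)))

ratio-ℚ : ∀ n₀ q m l → let s = suc n₀; r = root n₀ in
          2 * (s * suc q) * m ≤ s * suc q * l + (r * suc q + s) * m →
          (ℤ.+ 2 ℚ./ 1) ℚ.* (ℤ.+ m ℚ./ 1) ℚ.≤ (ℤ.+ l ℚ./ 1) ℚ.+ (√2-seq n₀ ℚ.+ unit q) ℚ.* (ℤ.+ m ℚ./ 1)
ratio-ℚ n₀ q m l h = begin
  (ℤ.+ 2 ℚ./ 1) ℚ.* (ℤ.+ m ℚ./ 1)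
    ≡⟨ /-* 2 0 m 0 ⟩
  ℤ.+ (2 * m) ℚ./ 1
    ≤⟨ /-mono (2 * m) 0 (l * D + (r * suc q + s) * m) d h′ ⟩
  ℤ.+ (l * D + (r * suc q + s) * m) ℚ./ D
    ≡⟨ /-+ (l * D) ((r * suc q + s) * m) d ⟨
  ℤ.+ (l * D) ℚ./ D ℚ.+ ℤ.+ ((r * suc q + s) * m) ℚ./ D
    ≡⟨ cong₂ ℚ._+_ (/-≡ (l * D) d l 0 (*-identityʳ (l * D))) times ⟩
  (ℤ.+ l ℚ./ 1) ℚ.+ (√2-seq n₀ ℚ.+ unit q) ℚ.* (ℤ.+ m ℚ./ 1) ∎
  where
  open ℚ.≤-Reasoning
  s r d D : ℕ
  s = suc n₀
  r = root n₀
  -- Chosen so that `suc d` computes to the common denominator `s * suc q`.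
  d = q + n₀ * suc q
  D = suc d
  lemma : ∀ s Q m l x → s * Q * l + x * m ≡ l * (s * Q) + x * m
  lemma = solve-∀
  lemma′ : ∀ x m → 2 * m * x ≡ 2 * x * m
  lemma′ = solve-∀
  h′ : 2 * m * D ≤ (l * D + (r * suc q + s) * m) * 1
  h′ = ≤-trans (≤-reflexive (lemma′ D m)) (≤-trans h (≤-reflexive
    (trans (lemma s (suc q) m l (r * suc q + s)) (sym (*-identityʳ _)))))
  plus : √2-seq n₀ ℚ.+ unit q ≡ ℤ.+ (r * suc q + s) ℚ./ D
  plus = trans (cong₂ ℚ._+_ (/-≡ r n₀ (r * suc q) d (rearrange r (suc q) s))
                            (/-≡ 1 q s d (trans (*-identityˡ D) refl)))
               (/-+ (r * suc q) s d)
    where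
    rearrange : ∀ r q s → r * (s * q) ≡ r * q * s
    rearrange = solve-∀
  times : ℤ.+ ((r * suc q + s) * m) ℚ./ D ≡ (√2-seq n₀ ℚ.+ unit q) ℚ.* (ℤ.+ m ℚ./ 1)
  times = trans (/-≡ x d x (d * 1) (cong (x *_) (*-identityʳ D)))
    (trans (sym (/-* (r * suc q + s) d m 0)) (cong (ℚ._* (ℤ.+ m ℚ./ 1)) (sym plus)))
    where x = (r * suc q + s) * m

module Accuracy (ε : ℝ) (δ : ℚ) (N₀ q n₀ r : ℕ)
  (δ≤ε : ∀ t → N₀ ≤ t → seq (fromℕ 0) t ℚ.+ δ ℚ.≤ seq ε t)
  (2/Q≤δ : unit q ℚ.+ unit q ℚ.≤ δ) (8Q²≤s : 8 * (suc q * suc q) ≤ suc n₀) (r≡root : r ≡ root n₀) where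

  open Parameters n₀ r r≡root

  private
    Q = suc q

  2L²≤s : 2 * (2 * Q * (2 * Q)) ≤ s
  2L²≤s = ≤-trans (≤-reflexive (lemma Q)) 8Q²≤s
    where
    lemma : ∀ Q → 2 * (2 * Q * (2 * Q)) ≡ 8 * (Q * Q)
    lemma = solve-∀

  4Q≤s : 4 * Q ≤ s
  4Q≤s = ≤-trans (*-mono-≤ {4} {8} (s≤s (s≤s (s≤s (s≤s z≤n)))) (m≤m*n Q Q)) 8Q²≤s

  -- The margin `δ` below `ε` absorbs `unit q` twice: once for the loss in `ratio`, once for
  -- replacing the fixed approximation `√2-seq n₀` by `√2-seq t`, which costs `unit t` and so at
  -- most `unit q` from `q` on.
  coefficient : ∀ t → N₀ ⊔ q ≤ t →
                (ℤ.+ 2 ℚ./ 1 ℚ.- √2-seq t ℚ.- seq ε t) ℚ.+ (√2-seq n₀ ℚ.+ unit q) ℚ.≤ ℤ.+ 2 ℚ./ 1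
  coefficient t N≤t = begin
    (two ℚ.- x ℚ.- e) ℚ.+ (√2-seq n₀ ℚ.+ unit q)
      ≤⟨ ℚ.+-monoʳ-≤ (two ℚ.- x ℚ.- e) (ℚ.+-monoˡ-≤ (unit q)
           (ℚ.≤-trans (√2-step n₀ t) (ℚ.+-monoʳ-≤ x (unit-mono (m⊔n≤o⇒n≤o N₀ q N≤t))))) ⟩
    (two ℚ.- x ℚ.- e) ℚ.+ (x ℚ.+ unit q ℚ.+ unit q)
      ≡⟨ lemma₁ two x e (unit q) ⟩
    two ℚ.- e ℚ.+ (unit q ℚ.+ unit q)
      ≤⟨ ℚ.+-monoʳ-≤ (two ℚ.- e) (ℚ.≤-trans 2/Q≤δ (subst (ℚ._≤ e) (ℚ.+-identityˡ δ) (δ≤ε t (m⊔n≤o⇒m≤o N₀ q N≤t)))) ⟩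
    two ℚ.- e ℚ.+ e
      ≡⟨ lemma₂ two e ⟩
    two ∎
    where
    open ℚ.≤-Reasoning
    open ℚSolver.+-*-Solver
    two = ℤ.+ 2 ℚ./ 1
    x = √2-seq t
    e = seq ε t
    lemma₁ : ∀ w x e u → (w ℚ.- x ℚ.- e) ℚ.+ (x ℚ.+ u ℚ.+ u) ≡ w ℚ.- e ℚ.+ (u ℚ.+ u)
    lemma₁ = solve 4 (λ w x e u → ((w :- x :- e) :+ (x :+ u :+ u)) := (w :- e :+ (u :+ u))) refl
    lemma₂ : ∀ w e → w ℚ.- e ℚ.+ e ≡ w
    lemma₂ = solve 2 (λ w e → (w :- e :+ e) := w) refl

  accurate : ∀ m l → l ≤ m → 2 * (2 * Q * k) * m ≤ suc (2 * Q) * (s + k) * l →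
             (fromℕ 2 -ℝ √2 -ℝ ε) *ℝ fromℕ m ≤ℝ fromℕ l
  accurate m l l≤m h η 0<η = N₀ ⊔ q , λ t N≤t →
    ℚ.≤-trans (bound t N≤t) (subst (ℚ._≤ l/1 ℚ.+ η) (ℚ.+-identityʳ l/1) (ℚ.+-monoʳ-≤ l/1 (ℚ.<⇒≤ 0<η)))
    where
    m/1 = ℤ.+ m ℚ./ 1
    l/1 = ℤ.+ l ℚ./ 1
    R = √2-seq n₀ ℚ.+ unit q
    size : 2 * (s * Q) * m ≤ s * Q * l + (root n₀ * Q + s) * m
    size = subst (λ r → 2 * (s * Q) * m ≤ s * Q * l + (r * Q + s) * m) r≡root (ratio Q m l 4Q≤s l≤m h)
    bound : ∀ t → N₀ ⊔ q ≤ t → (ℤ.+ 2 ℚ./ 1 ℚ.- √2-seq t ℚ.- seq ε t) ℚ.* m/1 ℚ.≤ l/1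
    bound t N≤t = begin
      c ℚ.* m/1                                ≡⟨ lemma₁ c R m/1 ⟩
      (c ℚ.+ R) ℚ.* m/1 ℚ.- R ℚ.* m/1          ≤⟨ ℚ.+-monoˡ-≤ (ℚ.- (R ℚ.* m/1)) (ℚ.≤-trans scaled (ratio-ℚ n₀ q m l size)) ⟩
      l/1 ℚ.+ R ℚ.* m/1 ℚ.- R ℚ.* m/1          ≡⟨ lemma₂ l/1 (R ℚ.* m/1) ⟩
      l/1 ∎
      where
      open ℚ.≤-Reasoning
      open ℚSolver.+-*-Solver
      c = ℤ.+ 2 ℚ./ 1 ℚ.- √2-seq t ℚ.- seq ε t
      scaled : (c ℚ.+ R) ℚ.* m/1 ℚ.≤ (ℤ.+ 2 ℚ./ 1) ℚ.* m/1
      scaled = ℚ.*-monoʳ-≤-nonNeg m/1 {{ℚ.nonNegative (/-mono 0 0 m 0 z≤n)}} (coefficient t N≤t)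
      lemma₁ : ∀ c R m → c ℚ.* m ≡ (c ℚ.+ R) ℚ.* m ℚ.- R ℚ.* m
      lemma₁ = solve 3 (λ c R m → (c :* m) := ((c :+ R) :* m :- R :* m)) refl
      lemma₂ : ∀ l x → l ℚ.+ x ℚ.- x ≡ l
      lemma₂ = solve 2 (λ l x → (l :+ x :- x) := l) refl

  algorithm-exists :
    Σ[ C ∈ ℕ ] Σ[ alg ∈ ((n : ℕ) → TwoPassAlgorithm n (C * n)) ]
    ((n : ℕ) (G : Graph n) (stream : List (Edge n)) → IsStreamOf G stream →
    IsMatching G (run (alg n) stream)
    × (fromℕ 2 -ℝ √2 -ℝ ε) *ℝ fromℕ (μ G) ≤ℝ fromℕ (length (run (alg n) stream)))
  algorithm-exists = suc k , algorithm s k , λ n G stream streamOf →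
      output-matching s k stream {G = G} streamOf
    , accurate (μ G) (length (run (algorithm s k n) stream))
        (μ-upper G _ (output-matching s k stream {G = G} streamOf))
        (output-size s k stream {G = G} streamOf a (2 * Q) s≡a+k 2L²≤s balance)
    where open Run using (output-matching; output-size)

theorem2 : (ε : ℝ) → fromℕ 0 <ℝ ε →
    Σ[ C ∈ ℕ ] Σ[ alg ∈ ((n : ℕ) → TwoPassAlgorithm n (C * n)) ]
    ((n : ℕ) (G : Graph n) (stream : List (Edge n)) → IsStreamOf G stream →
    IsMatching G (run (alg n) stream)
    × (fromℕ 2 -ℝ √2 -ℝ ε) *ℝ fromℕ (μ G) ≤ℝ fromℕ (length (run (alg n) stream)))
theorem2 ε (δ , 0<δ , N₀ , δ≤ε) =
  Accuracy.algorithm-exists ε δ N₀ q n₀ (root n₀) δ≤ε 2/Q≤δ (n≤1+n n₀) refl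
  where
  p q n₀ : ℕ
  p  = proj₁ (archimedean δ 0<δ)
  -- Then `suc q` is twice `suc p`, so two copies of `unit q` add up to `unit p`, which is below
  -- `δ`.
  q  = suc (p + p)
  -- This is 2 L² for L = 2Q, with Q = `suc q`: the size of `s` that `odd-sets` asks for.
  n₀ = 8 * (suc q * suc q)
  2/Q≤δ : unit q ℚ.+ unit q ℚ.≤ δ
  2/Q≤δ = ℚ.≤-trans (ℚ.≤-reflexive (/-+ 1 1 q))
    (ℚ.≤-trans (/-mono 2 q 1 p (≤-reflexive (lemma p))) (ℚ.<⇒≤ (proj₂ (archimedean δ 0<δ))))
    where
    lemma : ∀ p → 2 * suc p ≡ 1 * suc (suc (p + p))
    lemma = solve-∀
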